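{- For every odd integer $m\ge 3$, the Sperner systems $\mathcal{S}^m_1$ and $\mathcal{S}^m_2$ are strongly hypomorphic.
   Context: A set system over a finite set $A$ (the ground set) is a set of subsets of $A$, called blocks; it is a Sperner system if no block is included in another. Set systems $\mathcal A$ over $A$ and $\mathcal B$ over $B$ are isomorphic, $\mathcal A\equiv\mathcal B$, if there is a bijection $\sigma\colon A\to B$ with $\{\sigma(S):S\in\mathcal A\}=\mathcal B$. For a two-element subset $I$ of $A$, let $\theta_I$ be the equivalence relation on $A$ whose only nonsingleton class is $I$; for $S\subseteq A$ let $S_I=\{x/\theta_I:x\in S\}\subseteq A/\theta_I$; for a Sperner system $\mathcal A$ over $A$ let $\mathcal A_I=\{S_I:S\in\mathcal A\}$ and let $\mathcal A^*_I$ be the set of inclusion-minimal elements of $\mathcal A_I$, a Sperner system over $A/\theta_I$. Two Sperner systems $\mathcal A,\mathcal B$ over the same ground set $A$ are strongly hypomorphic if $\mathcal A^*_I\equiv\mathcal B^*_I$ for every two-element subset $I$ of $A$. Let $[m]=\{1,\dots,m\}$. For each $n\in[m]$ let $n'$ be a new element (a primed copy of $n$), and $S'=\{n':n\in S\}$ for $S\subseteq[m]$. Let $E_m=[m]\cup[m]'$ ($2m$ elements). Addition in $[m]$ is modulo $m$ with result in $[m]$; $X+q=\{x+q:x\in X\}$. Let $\rho$ be the permutation of $E_m$ with $\rho(j)=j+1$, $\rho(j')=(j+1)'$; for a set system $\mathcal A$ over $E_m$ let $\langle\mathcal A\rangle=\bigcup_{i\in[m]}\rho^i(\mathcal A)$.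 For $J\subseteq[m]$ let $F^m_J=J\cup([m]\setminus J)'$; $\mathcal F^m_1=\{F^m_J:|J|\text{ odd}\}$, $\mathcal F^m_2=\{F^m_J:|J|\text{ even}\}$. For disjoint $X,Y\subseteq[m]$ let $[X|Y]$ be the set of all $J\subseteq E_m$ such that $|\{x,x'\}\cap J|=2$ for all $x\in X$, $|\{y,y'\}\cap J|=0$ for all $y\in Y$, and $|\{z,z'\}\cap J|=1$ for all $z\in[m]\setminus(X\cup Y)$. Let $\langle X|Y\rangle=\langle[X|Y]\rangle=\bigcup_{q\in[m]}[X+q|Y+q]$. Let $\Omega=\{\langle X|Y\rangle: X,Y\subseteq[m],\ |X|=|Y|,\ X\cap Y=\emptyset\}\setminus\{\langle\emptyset|\emptyset\rangle\}$. Signature: for disjoint $X,Y\subseteq[m]$, $(X,Y)\ne(\emptyset,\emptyset)$, let $d_1\dots d_m$ be the string with $d_i=x$ if $i\in X$, $d_i=y$ if $i\in Y$, $d_i=z$ otherwise. Let $d'_1\dots d'_m$ be the unique string (indices cyclic modulo $m$) such that $d'_i=d_i$ if $d_i\in\{x,y\}$; and if $d_i=z$ then $d'_i\in\{\alpha,\beta\}$, $d'_i\ne d'_{i-1}$, with $d'_i=\beta$ if $d_{i-1}=x$ and $d'_i=\alpha$ if $d_{i-1}=y$. Then $\mathrm{sgn}(X,Y)$ is the set of those $e\in\{\alpha,\beta\}$ that occur an odd number of times in $d'_1\dots d'_m$; the singletons $\{\alpha\},\{\beta\}$ are written $\alpha,\beta$. It is invariant under replacing $(X,Y)$ by $(X+q,Y+q)$,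 and $\mathrm{sgn}\langle X|Y\rangle:=\mathrm{sgn}(X,Y)$ is well defined. For odd $m\ge3$ let $C_m=\{1,3,\dots,m-2\}$, $A_m=\{m\}\cup(C_m+1)\cup(C_m+1)'$, $B_m=\{m\}\cup C_m\cup C_m'$, and $$\mathcal H^m=\langle\{A_m,B_m\}\rangle\cup\bigcup\{Q\in\Omega\setminus\{\langle C_m|C_m+1\rangle,\langle C_m+1|C_m\rangle\}:\mathrm{sgn}\,Q=\beta\}.$$ For $i\in\{1,2\}$ let $\mathcal S^m_i=\mathcal H^m\cup\mathcal F^m_i$, a Sperner system over $E_m$. -}

module Defs where

open import Level using (0ℓ)
open import Data.Bool.Base using (if_then_else_)
open import Data.Fin.Base using (Fin; zero; suc; toℕ; _↑ˡ_; _↑ʳ_; splitAt; join)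
import Data.Fin.Properties as Fin
open import Data.Fin.Subset
  using (Subset; ⊥; ⁅_⁆; ∁; _∩_; _∪_; _∈_; _⊆_; ∣_∣)
open import Data.Fin.Subset.Properties using (_∈?_)
open import Data.Nat.Base using (ℕ; zero; suc; _+_; _∸_; parity)
import Data.Nat.Properties as ℕ
open import Data.Nat.DivMod using (_mod_)
open import Data.Parity.Base using (0ℙ; 1ℙ)
import Data.Parity.Properties as ℙ
open import Data.Product.Base using (∃; ∃-syntax; ∃₂; _×_; _,_)
open import Data.Sum.Base as Sum using (_⊎_; inj₁; inj₂)
open import Data.Vec.Base using (Vec; _++_; tabulate; lookup; count)
open import Function.Base using (id; _∘_)
open import Function.Bundles using (_⇔_)
open import Function.Structures using (IsBijection)
import Function.Endo.Propositional as Endo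
open import Relation.Binary.Core using (Rel)
open import Relation.Binary.Definitions using (DecidableEquality)
open import Relation.Binary.Structures using (IsEquivalence)
open import Relation.Binary.PropositionalEquality
  using (_≡_; _≢_; refl; sym; trans; cong)
open import Relation.Nullary using (¬_; does)
open import Relation.Nullary.Decidable using (_×-dec_; map′)
open import Relation.Unary as U using (Pred; Decidable; _≐_; ｛_｝)

Odd Even : ℕ → Set
Odd  n = parity n ≡ 1ℙ
Even n = parity n ≡ 0ℙ

-- A finite ground set is Fin n taken modulo an equivalence relation _≈_, which
-- is _≡_ unless a quotient is meant.  A subset of such a quotient is
-- represented by the union of its members, a subset of Fin n.

SetSystem : ℕ → Set₁
SetSystem n = Pred (Subset n) 0ℓ

Sperner : ∀ {n} → SetSystem n → Set
Sperner 𝒜 = ∀ {S T} → S U.∈ 𝒜 → T U.∈ 𝒜 → S ⊆ T → S ≡ T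

-- T is the image of S under f, in a codomain whose equality is _≈_.
IsImage : ∀ {k n} → Rel (Fin n) 0ℓ → (Fin k → Fin n) → Subset k → Subset n → Set
IsImage _≈_ f S T = ∀ y → y ∈ T ⇔ (∃[ x ] x ∈ S × f x ≈ y)

Image : ∀ {k n} → Rel (Fin n) 0ℓ → (Fin k → Fin n) → SetSystem k → SetSystem n
Image _≈_ f 𝒜 T = ∃[ S ] S U.∈ 𝒜 × IsImage _≈_ f S T

Isomorphic : ∀ {k n} → Rel (Fin k) 0ℓ → Rel (Fin n) 0ℓ →
             SetSystem k → SetSystem n → Set
Isomorphic _≈₁_ _≈₂_ 𝒜 ℬ = ∃[ σ ] IsBijection _≈₁_ _≈₂_ σ × Image _≈₂_ σ 𝒜 ≐ ℬ

Minimal : ∀ {n} → SetSystem n → SetSystem n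
Minimal 𝒜 S = S U.∈ 𝒜 × (∀ {T} → T U.∈ 𝒜 → T ⊆ S → T ≡ S)

θ : ∀ {n} → Subset n → Rel (Fin n) 0ℓ
θ I x y = x ≡ y ⊎ (x ∈ I × y ∈ I)

θ-isEquivalence : ∀ {n} (I : Subset n) → IsEquivalence (θ I)
θ-isEquivalence I = record
  { refl  = inj₁ refl
  ; sym   = Sum.map sym (λ (x∈I , y∈I) → y∈I , x∈I)
  ; trans = θ-trans
  }
  where
  θ-trans : ∀ {x y z} → θ I x y → θ I y z → θ I x z
  θ-trans (inj₁ refl)        yz                 = yz
  θ-trans (inj₂ xy)          (inj₁ refl)        = inj₂ xy
  θ-trans (inj₂ (x∈I , _))   (inj₂ (_ , z∈I))   = inj₂ (x∈I , z∈I)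

-- 𝒜_I; the quotient map is the identity on representatives.
_/_ : ∀ {n} → SetSystem n → Subset n → SetSystem n
𝒜 / I = Image (θ I) id 𝒜

_/*_ : ∀ {n} → SetSystem n → Subset n → SetSystem n
𝒜 /* I = Minimal (𝒜 / I)

-- The relation is only meant for Sperner systems, so it includes that condition.
record StronglyHypomorphic {n} (𝒜 ℬ : SetSystem n) : Set where
  field
    sperner₁   : Sperner 𝒜
    sperner₂   : Sperner ℬ
    isomorphic : ∀ I → ∣ I ∣ ≡ 2 → Isomorphic (θ I) (θ I) (𝒜 /* I) (ℬ /* I)

-- [m] = {1, …, m} is Fin m, with i : Fin m standing for label i.

label : ∀ {m} → Fin m → ℕ
label i = suc (toℕ i)

comprehension : ∀ {m} {P : Pred (Fin m) 0ℓ} → Decidable P → Subset m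
comprehension P? = tabulate (λ i → does (P? i))

infixl 6 _⊕_ _⊞_

_⊕_ : ∀ {m} → Fin m → ℕ → Fin m
_⊕_ {suc m} i q = (toℕ i + q) mod suc m

-- X + q = {x + q : x ∈ X}
_⊞_ : ∀ {m} → Subset m → ℕ → Subset m
X ⊞ q = comprehension (λ y → Fin.any? (λ x → (x ∈? X) ×-dec (x ⊕ q Fin.≟ y)))

data Symbol : Set where
  𝐱 𝐲 𝐳 α β : Symbol

_≟ˢ_ : DecidableEquality Symbol
a ≟ˢ b = map′ (code-injective a b) (cong code) (code a ℕ.≟ code b)
  where
  code : Symbol → ℕ
  code 𝐱 = 0
  code 𝐲 = 1
  code 𝐳 = 2
  code α = 3
  code β = 4

  decode : ℕ → Symbol
  decode 0 = 𝐱
  decode 1 = 𝐲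
  decode 2 = 𝐳
  decode 3 = α
  decode _ = β

  decode-code : ∀ a → decode (code a) ≡ a
  decode-code 𝐱 = refl
  decode-code 𝐲 = refl
  decode-code 𝐳 = refl
  decode-code α = refl
  decode-code β = refl

  code-injective : ∀ a b → code a ≡ code b → a ≡ b
  code-injective a b eq =
    trans (sym (decode-code a)) (trans (cong decode eq) (decode-code b))

-- d₁ … d_m
string : ∀ {m} → Subset m → Subset m → Vec Symbol m
string X Y = tabulate λ i →
  if does (i ∈? X) then 𝐱 else if does (i ∈? Y) then 𝐲 else 𝐳

-- d′₁ … d′_m.  The conditions relating d′ᵢ to its cyclic predecessor are stated
-- at the index i + 1, which runs over all of [m] as i does.
record IsResolution {m} (d d′ : Vec Symbol m) : Set where
  field
    keep-x  : ∀ i → lookup d i ≡ 𝐱 → lookup d′ i ≡ 𝐱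
    keep-y  : ∀ i → lookup d i ≡ 𝐲 → lookup d′ i ≡ 𝐲
    greek   : ∀ i → lookup d i ≡ 𝐳 → lookup d′ i ≡ α ⊎ lookup d′ i ≡ β
    differ  : ∀ i → lookup d (i ⊕ 1) ≡ 𝐳 → lookup d′ (i ⊕ 1) ≢ lookup d′ i
    after-x : ∀ i → lookup d (i ⊕ 1) ≡ 𝐳 → lookup d i ≡ 𝐱 → lookup d′ (i ⊕ 1) ≡ β
    after-y : ∀ i → lookup d (i ⊕ 1) ≡ 𝐳 → lookup d i ≡ 𝐲 → lookup d′ (i ⊕ 1) ≡ α

sgn : ∀ {m} → Subset m → Subset m → Pred Symbol 0ℓ
sgn X Y e = (e ≡ α ⊎ e ≡ β) ×
  (∃[ d′ ] IsResolution (string X Y) d′ × Odd (count (_≟ˢ e) d′))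

module _ (m : ℕ) where

  open Endo (Fin (m + m)) using (_^_)

  -- E_m is Fin (m + m): the element j is j ↑ˡ m and its primed copy j′ is
  -- m ↑ʳ j.  Accordingly S ++ T is the subset S ∪ T′ of E_m.

  ρ : Fin (m + m) → Fin (m + m)
  ρ = join m m ∘ Sum.map (_⊕ 1) (_⊕ 1) ∘ splitAt m

  ⟨_⟩ : SetSystem (m + m) → SetSystem (m + m)
  ⟨ 𝒜 ⟩ = U.⋃[ i ∶ Fin m ] Image _≡_ (ρ ^ label i) 𝒜

  F : Subset m → Subset (m + m)
  F J = J ++ ∁ J

  ℱ₁ ℱ₂ : SetSystem (m + m)
  ℱ₁ S = ∃[ J ] Odd  ∣ J ∣ × S ≡ F J
  ℱ₂ S = ∃[ J ] Even ∣ J ∣ × S ≡ F J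

  copies : Fin m → Subset (m + m)
  copies i = ⁅ i ↑ˡ m ⁆ ∪ ⁅ m ↑ʳ i ⁆

  [_∣_] : Subset m → Subset m → SetSystem (m + m)
  [ X ∣ Y ] J =
    (∀ i → i ∈ X         → ∣ copies i ∩ J ∣ ≡ 2) ×
    (∀ i → i ∈ Y         → ∣ copies i ∩ J ∣ ≡ 0) ×
    (∀ i → i ∈ ∁ (X ∪ Y) → ∣ copies i ∩ J ∣ ≡ 1)

  ⟨_∣_⟩ : Subset m → Subset m → SetSystem (m + m)
  ⟨ X ∣ Y ⟩ = ⟨ [ X ∣ Y ] ⟩

  -- The pairs (X , Y) for which ⟨ X ∣ Y ⟩ is a member of Ω.
  Ω : Subset m → Subset m → Set
  Ω X Y = ∣ X ∣ ≡ ∣ Y ∣ × X ∩ Y ≡ ⊥ × ¬ (⟨ X ∣ Y ⟩ ≐ ⟨ ⊥ ∣ ⊥ ⟩)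

  -- The following are used only for odd m ≥ 3.

  C : Subset m
  C = comprehension (λ i → (parity (label i) ℙ.≟ 1ℙ) ×-dec (label i ℕ.≤? m ∸ 2))

  last : Subset m
  last = comprehension (λ i → label i ℕ.≟ m)

  A B : Subset (m + m)
  A = (last ∪ (C ⊞ 1)) ++ (C ⊞ 1)
  B = (last ∪ C) ++ C

  -- A member Q = ⟨ X ∣ Y ⟩ of Ω is given by a pair (X , Y); sgn Q is sgn X Y, which
  -- is the same for all pairs giving Q.
  ℋ : SetSystem (m + m)
  ℋ = ⟨ ｛ A ｝ U.∪ ｛ B ｝ ⟩ U.∪ λ J → ∃₂ λ X Y →
    Ω X Y ×
    ¬ (⟨ X ∣ Y ⟩ ≐ ⟨ C ∣ C ⊞ 1 ⟩) ×
    ¬ (⟨ X ∣ Y ⟩ ≐ ⟨ C ⊞ 1 ∣ C ⟩) ×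
    sgn X Y ≐ ｛ β ｝ ×
    J U.∈ ⟨ X ∣ Y ⟩

  𝒮₁ 𝒮₂ : SetSystem (m + m)
  𝒮₁ = ℋ U.∪ ℱ₁
  𝒮₂ = ℋ U.∪ ℱ₂

{-# OPTIONS --safe #-}
module Submission where

-- The swap τ of k and k′ exchanges the families F_J with |J| odd and |J| even and preserves every
-- ⟨X|Y⟩; it fixes all rotations of A and B except the two whose only index with one copy is k.
-- If I = {j, j′}, then F_J and its image under the swap at j agree modulo θ_I.  If I lies over two
-- distinct indices i and j, it suffices to find k ≠ i, j such that modulo θ_I the two exceptional
-- blocks contain other blocks of both systems, hence do not matter for the minimal elements: then τ
-- induces the isomorphism.  We may assume j = i + d with d odd.
-- If i ≠ j + 2, take k = j + 2, adjacent to neither.  Exchanging the element over k for one over the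
-- empty index among i and j gives a block with a single 𝐳, between two 𝐱.
-- Otherwise i and j are the neighbours of k = j + 1, and one exchange gives a block with 𝐳 exactly
-- at three consecutive indices, preceded by 𝐲 (for m = 3, a block F_J of the required parity).
-- In both cases the signature is β.

open import Defs
open import Level using (0ℓ)
import Function.Endo.Propositional as Endo
import Data.Nat.Properties as ℕ
open import Algebra.Properties.CommutativeMonoid.Sum ℕ.+-0-commutativeMonoid
  using (sum; sum-cong-≗; ∑-distrib-+; sum-permute)
open import Data.Bool.Base using (Bool; true; false; not; _∧_; _∨_; if_then_else_)
open import Data.Bool.Properties using (not-involutive)
open import Data.Fin.Base using (Fin; zero; suc; toℕ; fromℕ; _↑ˡ_; _↑ʳ_; splitAt)
import Data.Fin.Properties as Fin
open import Data.Fin.Permutation using (Permutation; permutation)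
open import Data.Fin.Subset using (Subset; ⊥; ⁅_⁆; ∁; _∩_; _∪_; _∈_; _∉_; _⊆_; ∣_∣)
open import Data.Fin.Subset.Properties
  using (_∈?_; ⊆-antisym; p⊂q⇒∣p∣<∣q∣; ∪-identityˡ; ∪-identityʳ; x∈p∪q⁺; x∈p∪q⁻; x∈∁p⇒x∉p; x∉p⇒x∈∁p)
open import Data.Nat.Base
  using (ℕ; zero; suc; _+_; _∸_; _≤_; _<_; z≤n; s≤s; parity)
open import Data.Nat.DivMod using (_%_; m%n<n; %-distribˡ-+; m%n%n≡m%n; m<n⇒m%n≡m; [m+n]%n≡m%n)
open import Data.Parity.Base as ℙ using (Parity; 0ℙ; 1ℙ; _⁻¹)
import Data.Parity.Properties as ℙ
open import Data.Product.Base using (∃-syntax; ∃₂; _×_; _,_; proj₁; proj₂)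
open import Data.Sum.Base as Sum using (_⊎_; inj₁; inj₂)
open import Data.Vec.Base using (Vec; []; _∷_; here; there; _++_; lookup; tabulate; count; _[_]≔_)
open import Data.Vec.Properties
  using ([]=⇒lookup; lookup⇒[]=; lookup∘tabulate; tabulate∘lookup; tabulate-cong; lookup-map;
         lookup-zipWith; lookup-replicate; lookup-++ˡ; lookup-++ʳ; lookup∘updateAt; lookup∘updateAt′)
open import Function.Base using (id; _∘_)
open import Function.Bundles using (mk⇔; Equivalence)
open import Function.Structures using (IsBijection)
open import Relation.Binary.Definitions using (Tri; tri<; tri≈; tri>)
open import Relation.Binary.PropositionalEquality
  using (_≡_; _≢_; refl; sym; trans; cong; cong₂; subst; subst₂; module ≡-Reasoning)
open import Relation.Binary.Structures using (IsEquivalence)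
open import Relation.Nullary using (¬_; Dec; yes; no; does; contradiction)
open import Relation.Nullary.Decidable using (dec-true; dec-false; _×-dec_; _⊎-dec_)
open import Relation.Unary as U using (Pred; _≐_; ｛_｝)

-- The obstacle: changing the parity of the blocks F_J takes a swap at a single index, but over its
-- `𝐳` a rotation of `A` or `B` contains only the unprimed copy, and `ℋ` has no block with the same
-- word and the primed copy, because ⟨C|C+1⟩ and ⟨C+1|C⟩ are left out of it. So no such swap maps
-- one system onto the other, and the two exceptional blocks have to be made harmless in the
-- quotient. This is possible because away from k their words alternate between `𝐱` and `𝐲`. If the
-- arc from i to j has odd length and avoids k, one of these two indices is full and the other
-- empty. Then I identifies an element of the block with one over the empty index, and adding the
-- latter leaves the image in the quotient unchanged. This pays for the removal of an element
-- elsewhere, chosen so that the result is a block. All blocks have m elements, because |X| = |Y|.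
-- This gives the Sperner property, and it is why an element is exchanged and not merely removed.

private variable
  m n : ℕ

-- Boolean vectors

bit : Bool → ℕ
bit b = if b then 1 else 0

-- Counts and cardinalities are turned into sums over indices, which can be added pointwise and
-- reindexed by a rotation.
count-sum : ∀ {A : Set} {P : Pred A 0ℓ} (P? : U.Decidable P) (xs : Vec A n) →
            count P? xs ≡ sum (λ i → bit (does (P? (lookup xs i))))
count-sum P? []       = refl
count-sum P? (x ∷ xs) with does (P? x)
... | true  = cong suc (count-sum P? xs)
... | false = count-sum P? xs

card-sum : (S : Subset n) → ∣ S ∣ ≡ sum (bit ∘ lookup S)
card-sum []          = refl
card-sum (true  ∷ S) = cong suc (card-sum S)
card-sum (false ∷ S) = card-sum S

sum-point : (f : Fin n → ℕ) (e : Fin n) → f e ≡ 1 → (∀ i → i ≢ e → f i ≡ 0) → sum f ≡ 1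
sum-point {suc n} f zero    fe≡1 f≡0 = cong₂ _+_ fe≡1 (trans (sum-cong-≗ (λ i → f≡0 (suc i) λ ()))
    (sum-zero n))
  where
  sum-zero : ∀ n → sum {n} (λ _ → 0) ≡ 0
  sum-zero zero    = refl
  sum-zero (suc n) = sum-zero n
sum-point f (suc e) fe≡1 f≡0 =
  cong₂ _+_ (f≡0 zero λ ()) (sum-point (f ∘ suc) e fe≡1 (λ i i≢e → f≡0 (suc i) (i≢e ∘ Fin.suc-injective)))

sum-ones : ∀ n → sum {n} (λ _ → 1) ≡ n
sum-ones zero    = refl
sum-ones (suc n) = cong suc (sum-ones n)

sum-↑ : ∀ m {n} (f : Fin (m + n) → ℕ) → sum f ≡ sum (f ∘ (_↑ˡ n)) + sum (f ∘ (m ↑ʳ_))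
sum-↑ zero    f = refl
sum-↑ (suc m) f =
  trans (cong (f zero +_) (sum-↑ m (f ∘ suc))) (sym (ℕ.+-assoc (f zero) _ _))

∈-pred : {S : Subset n} {x : Fin n} → lookup S x ≡ true → x ∈ S
∈-pred {S = S} {x} = lookup⇒[]= x S

∈-bool : (S : Subset n) (x : Fin n) → does (x ∈? S) ≡ lookup S x
∈-bool S x with x ∈? S
... | yes x∈S = sym ([]=⇒lookup x∈S)
... | no  x∉S with lookup S x in eq
...   | true  = contradiction (∈-pred eq) x∉S
...   | false = refl

∉⇒false : {S : Subset n} {x : Fin n} → x ∉ S → lookup S x ≡ false
∉⇒false {S = S} {x} x∉S with lookup S x in eq
... | true  = contradiction (∈-pred eq) x∉S
... | false = refl

false⇒∉ : {S : Subset n} {x : Fin n} → lookup S x ≡ false → x ∉ S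
false⇒∉ eq x∈S with () ← trans (sym ([]=⇒lookup x∈S)) eq

subset-ext : {S T : Subset n} → (∀ x → lookup S x ≡ lookup T x) → S ≡ T
subset-ext {S = S} {T} eq = trans (sym (tabulate∘lookup S)) (trans (tabulate-cong eq) (tabulate∘lookup T))

⊆∧∣∣≡⇒≡ : {S T : Subset n} → S ⊆ T → ∣ S ∣ ≡ ∣ T ∣ → S ≡ T
⊆∧∣∣≡⇒≡ {S = S} {T} S⊆T ∣S∣≡∣T∣ = ⊆-antisym S⊆T T⊆S
  where
  T⊆S : T ⊆ S
  T⊆S {x} x∈T with x ∈? S
  ... | yes x∈S = x∈S
  ... | no  x∉S = contradiction ∣S∣≡∣T∣ (ℕ.<⇒≢ (p⊂q⇒∣p∣<∣q∣ (S⊆T , x , x∈T , x∉S)))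

∈-comprehension⁺ : {P : Pred (Fin n) 0ℓ} (P? : U.Decidable P) {i : Fin n} → P i → i ∈ comprehension P?
∈-comprehension⁺ P? {i} p = ∈-pred (trans (lookup∘tabulate _ i) helper)
  where
  helper : does (P? i) ≡ true
  helper with P? i
  ... | yes _ = refl
  ... | no ¬p = contradiction p ¬p

∈-comprehension⁻ : {P : Pred (Fin n) 0ℓ} (P? : U.Decidable P) {i : Fin n} → i ∈ comprehension P? → P i
∈-comprehension⁻ P? {i} i∈ with P? i | trans (sym (lookup∘tabulate (does ∘ P?) i)) ([]=⇒lookup i∈)
... | yes p | _ = p
... | no _  | ()

∣⁅x⁆∩S∣ : (x : Fin n) (S : Subset n) → ∣ ⁅ x ⁆ ∩ S ∣ ≡ bit (lookup S x)
∣⁅x⁆∩S∣ {suc n} zero (b ∷ S) = trans (helper b) (trans (cong (bit b +_) (∣⊥∩S∣ S)) (ℕ.+-identityʳ _))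
  where
  ∣⊥∩S∣ : (S : Subset m) → ∣ ⊥ ∩ S ∣ ≡ 0
  ∣⊥∩S∣ []      = refl
  ∣⊥∩S∣ (_ ∷ S) = ∣⊥∩S∣ S
  helper : ∀ b → ∣ b ∷ (⊥ ∩ S) ∣ ≡ bit b + ∣ ⊥ ∩ S ∣
  helper true  = refl
  helper false = refl
∣⁅x⁆∩S∣ (suc x) (b ∷ S) = ∣⁅x⁆∩S∣ x S

∣⁅x,y⁆∩S∣ : {x y : Fin n} → x ≢ y → (S : Subset n) →
            ∣ (⁅ x ⁆ ∪ ⁅ y ⁆) ∩ S ∣ ≡ bit (lookup S x) + bit (lookup S y)
∣⁅x,y⁆∩S∣ {x = zero}  {zero}  x≢y S = contradiction refl x≢y
∣⁅x,y⁆∩S∣ {x = zero}  {suc y} x≢y (true ∷ S) =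
  cong suc (trans (cong (λ p → ∣ p ∩ S ∣) (∪-identityˡ ⁅ y ⁆)) (∣⁅x⁆∩S∣ y S))
∣⁅x,y⁆∩S∣ {x = zero}  {suc y} x≢y (false ∷ S) =
  trans (cong (λ p → ∣ p ∩ S ∣) (∪-identityˡ ⁅ y ⁆)) (∣⁅x⁆∩S∣ y S)
∣⁅x,y⁆∩S∣ {x = suc x} {zero}  x≢y (true ∷ S) =
  trans (cong suc (trans (cong (λ p → ∣ p ∩ S ∣) (∪-identityʳ ⁅ x ⁆)) (∣⁅x⁆∩S∣ x S))) (ℕ.+-comm 1 _)
∣⁅x,y⁆∩S∣ {x = suc x} {zero}  x≢y (false ∷ S) =
  trans (trans (cong (λ p → ∣ p ∩ S ∣) (∪-identityʳ ⁅ x ⁆)) (∣⁅x⁆∩S∣ x S)) (sym (ℕ.+-identityʳ _))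
∣⁅x,y⁆∩S∣ {x = suc x} {suc y} x≢y (b ∷ S) = ∣⁅x,y⁆∩S∣ (x≢y ∘ cong suc) S

-- Preimages

-- Images are given only as a relation. For a bijection `f`, however, `T` is the image of `S`
-- exactly when `S` is the preimage of `T`, and preimages are computed by `lookup`. All rotations
-- and swaps are therefore treated through preimages.
pull : (Fin m → Fin n) → Subset n → Subset m
pull f S = tabulate (lookup S ∘ f)

lookup-pull : (f : Fin m → Fin n) (S : Subset n) (x : Fin m) → lookup (pull f S) x ≡ lookup S (f x)
lookup-pull f S = lookup∘tabulate (lookup S ∘ f)

∈-pull⁺ : (f : Fin m → Fin n) {S : Subset n} {x : Fin m} → f x ∈ S → x ∈ pull f S
∈-pull⁺ f {x = x} fx∈S = ∈-pred (trans (lookup∘tabulate _ x) ([]=⇒lookup fx∈S))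

∈-pull⁻ : (f : Fin m → Fin n) {S : Subset n} {x : Fin m} → x ∈ pull f S → f x ∈ S
∈-pull⁻ f {x = x} x∈ = ∈-pred (trans (sym (lookup∘tabulate _ x)) ([]=⇒lookup x∈))

image⇒≡pull : {f : Fin m → Fin n} → (∀ {x y} → f x ≡ f y → x ≡ y) →
              ∀ {S T} → IsImage _≡_ f S T → S ≡ pull f T
image⇒≡pull {f = f} f-inj {S} {T} im = ⊆-antisym
  (λ {x} x∈S → ∈-pull⁺ f (Equivalence.from (im (f x)) (x , x∈S , refl)))
  (λ {x} x∈ → let (y , y∈S , eq) = Equivalence.to (im (f x)) (∈-pull⁻ f x∈) in subst (_∈ S) (f-inj eq) y∈S)

pull-image : {f : Fin m → Fin n} → (∀ y → ∃[ x ] f x ≡ y) → ∀ T → IsImage _≡_ f (pull f T) T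
pull-image {f = f} f-surj T y = mk⇔
  (λ y∈T → let (x , eq) = f-surj y in x , ∈-pull⁺ f (subst (_∈ T) (sym eq) y∈T) , eq)
  (λ (x , x∈ , eq) → subst (_∈ T) eq (∈-pull⁻ f x∈))

-- Cyclic addition

toℕ-⊕ : (i : Fin (suc m)) (q : ℕ) → toℕ (i ⊕ q) ≡ (toℕ i + q) % suc m
toℕ-⊕ {m} i q = Fin.toℕ-fromℕ< (m%n<n (toℕ i + q) (suc m))

⊕-assoc : (i : Fin (suc m)) (p q : ℕ) → i ⊕ p ⊕ q ≡ i ⊕ (p + q)
⊕-assoc {m} i p q = Fin.toℕ-injective (begin
  toℕ (i ⊕ p ⊕ q)                                  ≡⟨ toℕ-⊕ (i ⊕ p) q ⟩
  (toℕ (i ⊕ p) + q) % suc m                        ≡⟨ cong (λ a → (a + q) % suc m) (toℕ-⊕ i p) ⟩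
  ((toℕ i + p) % suc m + q) % suc m                ≡⟨ %-distribˡ-+ ((toℕ i + p) % suc m) q (suc m) ⟩
  ((toℕ i + p) % suc m % suc m + q % suc m) % suc m ≡⟨ cong (λ a → (a + q % suc m) % suc m)
    (m%n%n≡m%n (toℕ i + p) (suc m)) ⟩
  ((toℕ i + p) % suc m + q % suc m) % suc m        ≡⟨ %-distribˡ-+ (toℕ i + p) q (suc m) ⟨
  (toℕ i + p + q) % suc m                          ≡⟨ cong (_% suc m) (ℕ.+-assoc (toℕ i) p q) ⟩
  (toℕ i + (p + q)) % suc m                        ≡⟨ toℕ-⊕ i (p + q) ⟨
  toℕ (i ⊕ (p + q))                                ∎)
  where open ≡-Reasoning

⊕-comm : (i : Fin (suc m)) (p q : ℕ) → i ⊕ p ⊕ q ≡ i ⊕ q ⊕ p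
⊕-comm i p q = trans (⊕-assoc i p q) (trans (cong (i ⊕_) (ℕ.+-comm p q)) (sym (⊕-assoc i q p)))

⊕-suc : (i : Fin (suc m)) (p : ℕ) → i ⊕ p ⊕ 1 ≡ i ⊕ suc p
⊕-suc i p = trans (⊕-assoc i p 1) (cong (i ⊕_) (ℕ.+-comm p 1))

⊕-period : (i : Fin (suc m)) → i ⊕ suc m ≡ i
⊕-period {m} i = Fin.toℕ-injective (trans (toℕ-⊕ i (suc m))
  (trans ([m+n]%n≡m%n (toℕ i) (suc m)) (m<n⇒m%n≡m (Fin.toℕ<n i))))

⊕-zero : (i : Fin (suc m)) → i ⊕ 0 ≡ i
⊕-zero {m} i = Fin.toℕ-injective (trans (toℕ-⊕ i 0)
  (trans (cong (_% suc m) (ℕ.+-identityʳ (toℕ i))) (m<n⇒m%n≡m (Fin.toℕ<n i))))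

⊕-inverseʳ : (i : Fin (suc m)) {q : ℕ} → q ≤ suc m → i ⊕ q ⊕ (suc m ∸ q) ≡ i
⊕-inverseʳ i {q} q≤ = trans (⊕-assoc i q _) (trans (cong (i ⊕_) (ℕ.m+[n∸m]≡n q≤)) (⊕-period i))

⊕-inverseˡ : (i : Fin (suc m)) {q : ℕ} → q ≤ suc m → i ⊕ (suc m ∸ q) ⊕ q ≡ i
⊕-inverseˡ i {q} q≤ = trans (⊕-comm i _ q) (⊕-inverseʳ i q≤)

⊕-injective : {q : ℕ} → q ≤ suc m → {i j : Fin (suc m)} → i ⊕ q ≡ j ⊕ q → i ≡ j
⊕-injective {m} {q} q≤ {i} {j} eq =
  trans (sym (⊕-inverseʳ i q≤)) (trans (cong (_⊕ (suc m ∸ q)) eq) (⊕-inverseʳ j q≤))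

⊕-reach : (i j : Fin (suc m)) → ∃[ t ] t < suc m × j ≡ i ⊕ t
⊕-reach {m} i j = toℕ t , Fin.toℕ<n t , Fin.toℕ-injective (begin
  toℕ j                                           ≡⟨ cong toℕ (⊕-inverseˡ j i≤) ⟨
  toℕ (t ⊕ toℕ i)                                 ≡⟨ toℕ-⊕ t (toℕ i) ⟩
  (toℕ t + toℕ i) % suc m                         ≡⟨ cong (_% suc m) (ℕ.+-comm (toℕ t) (toℕ i)) ⟩
  (toℕ i + toℕ t) % suc m                         ≡⟨ toℕ-⊕ i (toℕ t) ⟨
  toℕ (i ⊕ toℕ t)                                 ∎)
  where
  open ≡-Reasoning
  i≤ : toℕ i ≤ suc m
  i≤ = ℕ.<⇒≤ (Fin.toℕ<n i)
  t = j ⊕ (suc m ∸ toℕ i)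

⊕-cancelˡ : (i : Fin (suc m)) {p q : ℕ} → p < suc m → q < suc m → i ⊕ p ≡ i ⊕ q → p ≡ q
⊕-cancelˡ {m} i {p} {q} p< q< eq = begin
  p                ≡⟨ back p< ⟨
  toℕ (i ⊕ p ⊕ r)  ≡⟨ cong (λ j → toℕ (j ⊕ r)) eq ⟩
  toℕ (i ⊕ q ⊕ r)  ≡⟨ back q< ⟩
  q                ∎
  where
  open ≡-Reasoning
  r = suc m ∸ toℕ i
  back : ∀ {s} → s < suc m → toℕ (i ⊕ s ⊕ r) ≡ s
  back {s} s< = begin
    toℕ (i ⊕ s ⊕ r)           ≡⟨ cong toℕ (⊕-assoc i s r) ⟩
    toℕ (i ⊕ (s + r))         ≡⟨ toℕ-⊕ i (s + r) ⟩
    (toℕ i + (s + r)) % suc m ≡⟨ cong (_% suc m) (trans (cong (toℕ i +_) (ℕ.+-comm s r))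
      (sym (ℕ.+-assoc (toℕ i) r s))) ⟩
    (toℕ i + r + s) % suc m   ≡⟨ cong (λ a → (a + s) % suc m) (ℕ.m+[n∸m]≡n (ℕ.<⇒≤ (Fin.toℕ<n i))) ⟩
    (suc m + s) % suc m       ≡⟨ cong (_% suc m) (ℕ.+-comm (suc m) s) ⟩
    (s + suc m) % suc m       ≡⟨ [m+n]%n≡m%n s (suc m) ⟩
    s % suc m                 ≡⟨ m<n⇒m%n≡m s< ⟩
    s                         ∎

rotation : {q : ℕ} → q ≤ suc m → Permutation (suc m) (suc m)
rotation {m} {q} q≤ = permutation (_⊕ q) (_⊕ (suc m ∸ q)) (λ i → ⊕-inverseˡ i q≤) (λ i → ⊕-inverseʳ i q≤)

sum-rotate : {q : ℕ} → q ≤ suc m → (f : Fin (suc m) → ℕ) → sum (λ i → f (i ⊕ q)) ≡ sum f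
sum-rotate q≤ f = sym (sum-permute f (rotation q≤))

-- Brackets

pick : Bool → Bool → Symbol
pick true  _     = 𝐱
pick false true  = 𝐲
pick false false = 𝐳

letter : Subset m → Subset m → Fin m → Symbol
letter X Y i = pick (lookup X i) (lookup Y i)

lookup-string : (X Y : Subset m) (i : Fin m) → lookup (string X Y) i ≡ letter X Y i
lookup-string X Y i = trans (lookup∘tabulate _ i) helper
  where
  helper : (if does (i ∈? X) then 𝐱 else if does (i ∈? Y) then 𝐲 else 𝐳) ≡ letter X Y i
  helper rewrite ∈-bool X i | ∈-bool Y i with lookup X i | lookup Y i
  ... | true  | _     = refl
  ... | false | true  = refl
  ... | false | false = refl

Disjoint : Subset m → Subset m → Set
Disjoint X Y = ∀ i → lookup X i ≡ true → lookup Y i ≡ false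

∩≡⊥⇒disjoint : {X Y : Subset m} → X ∩ Y ≡ ⊥ → Disjoint X Y
∩≡⊥⇒disjoint {X = X} {Y} eq i Xi with trans (sym (lookup-zipWith _∧_ i X Y))
    (trans (cong (λ p → lookup p i) eq) (lookup-replicate i false))
... | p rewrite Xi = p

disjoint⇒∩≡⊥ : {X Y : Subset m} → Disjoint X Y → X ∩ Y ≡ ⊥
disjoint⇒∩≡⊥ {X = X} {Y} dis = subset-ext λ i →
  trans (lookup-zipWith _∧_ i X Y) (trans (helper i) (sym (lookup-replicate i false)))
  where
  helper : ∀ i → lookup X i ∧ lookup Y i ≡ false
  helper i with lookup X i in eq
  ... | true  = dis i eq
  ... | false = refl

module GroundSet (m : ℕ) where

  el : Bool → Fin m → Fin (m + m)
  el true  i = i ↑ˡ m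
  el false i = m ↑ʳ i

  -- A view of the ground set: after matching on it, one clause handles both copies of an index.
  data Over : Fin (m + m) → Set where
    over : ∀ s i → Over (el s i)

  over? : (x : Fin (m + m)) → Over x
  over? x with splitAt m x | Fin.join-splitAt m m x
  ... | inj₁ i | refl = over true i
  ... | inj₂ i | refl = over false i

  el-injective : ∀ {s s′} {i i′ : Fin m} → el s i ≡ el s′ i′ → s ≡ s′ × i ≡ i′
  el-injective {true}  {true}  eq = refl , Fin.↑ˡ-injective m _ _ eq
  el-injective {false} {false} eq = refl , Fin.↑ʳ-injective m _ _ eq
  el-injective {true}  {false} {i} {i′} eq
    with () ← trans (sym (Fin.splitAt-↑ˡ m i m)) (trans (cong (splitAt m) eq) (Fin.splitAt-↑ʳ m m i′))
  el-injective {false} {true}  {i} {i′} eq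
    with () ← trans (sym (Fin.splitAt-↑ʳ m m i)) (trans (cong (splitAt m) eq) (Fin.splitAt-↑ˡ m i′ m))

  mix : Bool → Bool → Symbol
  mix true  true  = 𝐱
  mix true  false = 𝐳
  mix false true  = 𝐳
  mix false false = 𝐲

  -- The letter 𝐱, 𝐲 or 𝐳 says that S contains both, none or one of i and i′.
  kind : Subset (m + m) → Fin m → Symbol
  kind S i = mix (lookup S (el true i)) (lookup S (el false i))

  weight : Symbol → ℕ
  weight 𝐱 = 2
  weight 𝐲 = 0
  weight _ = 1

  weight-mix : ∀ a b → weight (mix a b) ≡ bit a + bit b
  weight-mix true  true  = refl
  weight-mix true  false = refl
  weight-mix false true  = refl
  weight-mix false false = refl

  card-kind : (S : Subset (m + m)) → ∣ S ∣ ≡ sum (weight ∘ kind S)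
  card-kind S = begin
    ∣ S ∣
      ≡⟨ card-sum S ⟩
    sum (bit ∘ lookup S)
      ≡⟨ sum-↑ m (bit ∘ lookup S) ⟩
    sum (bit ∘ lookup S ∘ el true) + sum (bit ∘ lookup S ∘ el false)
      ≡⟨ ∑-distrib-+ (bit ∘ lookup S ∘ el true) (bit ∘ lookup S ∘ el false) ⟨
    sum (λ i → bit (lookup S (el true i)) + bit (lookup S (el false i)))
      ≡⟨ sum-cong-≗ (λ i → weight-mix (lookup S (el true i)) _) ⟨
    sum (weight ∘ kind S) ∎
    where open ≡-Reasoning

  ∣copies∩∣ : (i : Fin m) (J : Subset (m + m)) → ∣ copies m i ∩ J ∣ ≡ weight (kind J i)
  ∣copies∩∣ i J = trans
    (∣⁅x,y⁆∩S∣ (λ eq → case-≢ (proj₁ (el-injective {true} {false} eq))) J)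
    (sym (weight-mix (lookup J (el true i)) _))
    where
    case-≢ : true ≢ false
    case-≢ ()

  bracket⇒kind : {X Y : Subset m} {J : Subset (m + m)} → ([_∣_] m X Y) J → ∀ i → kind J i ≡ letter X Y i
  bracket⇒kind {X} {Y} {J} (on-X , on-Y , off) i
    with lookup X i in eqX | lookup Y i in eqY
  ... | true  | _     = 2⇒𝐱 (lookup J (el true i)) _ (trans (sym (∣copies∩∣ i J)) (on-X i (∈-pred eqX)))
    where
    2⇒𝐱 : ∀ a b → weight (mix a b) ≡ 2 → mix a b ≡ 𝐱
    2⇒𝐱 true true _ = refl
    2⇒𝐱 true false ()
    2⇒𝐱 false true ()
    2⇒𝐱 false false ()
  ... | false | true  = 0⇒𝐲 (lookup J (el true i)) _ (trans (sym (∣copies∩∣ i J)) (on-Y i (∈-pred eqY)))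
    where
    0⇒𝐲 : ∀ a b → weight (mix a b) ≡ 0 → mix a b ≡ 𝐲
    0⇒𝐲 false false _ = refl
    0⇒𝐲 true true ()
    0⇒𝐲 true false ()
    0⇒𝐲 false true ()
  ... | false | false = 1⇒𝐳 (lookup J (el true i)) _ (trans (sym (∣copies∩∣ i J)) (off i (x∉p⇒x∈∁p i∉)))
    where
    1⇒𝐳 : ∀ a b → weight (mix a b) ≡ 1 → mix a b ≡ 𝐳
    1⇒𝐳 true  false _ = refl
    1⇒𝐳 false true  _ = refl
    1⇒𝐳 true true ()
    1⇒𝐳 false false ()
    i∉ : i ∉ X ∪ Y
    i∉ i∈ with x∈p∪q⁻ X Y i∈
    ... | inj₁ i∈X = false⇒∉ eqX i∈X
    ... | inj₂ i∈Y = false⇒∉ eqY i∈Y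

  kind⇒bracket : {X Y : Subset m} {J : Subset (m + m)} → Disjoint X Y →
                 (∀ i → kind J i ≡ letter X Y i) → ([_∣_] m X Y) J
  kind⇒bracket {X} {Y} {J} dis kind≡ = on-X , on-Y , off
    where
    size : ∀ i {a b} → lookup X i ≡ a → lookup Y i ≡ b → ∣ copies m i ∩ J ∣ ≡ weight (pick a b)
    size i refl refl = trans (∣copies∩∣ i J) (cong weight (kind≡ i))
    on-X : ∀ i → i ∈ X → ∣ copies m i ∩ J ∣ ≡ 2
    on-X i i∈X = size i ([]=⇒lookup i∈X) refl
    on-Y : ∀ i → i ∈ Y → ∣ copies m i ∩ J ∣ ≡ 0
    on-Y i i∈Y with lookup X i in eq
    ... | false = size i eq ([]=⇒lookup i∈Y)
    ... | true  with () ← trans (sym ([]=⇒lookup i∈Y)) (dis i eq)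
    off : ∀ i → i ∈ ∁ (X ∪ Y) → ∣ copies m i ∩ J ∣ ≡ 1
    off i i∈ = size i (∉⇒false (x∈∁p⇒x∉p i∈ ∘ x∈p∪q⁺ ∘ inj₁)) (∉⇒false (x∈∁p⇒x∉p i∈ ∘ x∈p∪q⁺ ∘ inj₂))

  -- Index by index, the number of copies in `J` is 1, plus 1 on `X`, minus 1 on `Y`; the last term
  -- stays on the left to avoid truncated subtraction. For `X` and `Y` of equal size this yields m
  -- elements.
  kind⇒card : {X Y : Subset m} {J : Subset (m + m)} → Disjoint X Y →
              (∀ i → kind J i ≡ letter X Y i) → ∣ J ∣ + ∣ Y ∣ ≡ m + ∣ X ∣
  kind⇒card {X} {Y} {J} dis kind≡ = begin
    ∣ J ∣ + ∣ Y ∣                                    ≡⟨ cong₂ _+_ (card-kind J) (card-sum Y) ⟩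
    sum (weight ∘ kind J) + sum (bit ∘ lookup Y)     ≡⟨ ∑-distrib-+ (weight ∘ kind J) (bit ∘ lookup Y) ⟨
    sum (λ i → weight (kind J i) + bit (lookup Y i)) ≡⟨ sum-cong-≗ pointwise ⟩
    sum (λ i → 1 + bit (lookup X i))                 ≡⟨ ∑-distrib-+ (λ _ → 1) (bit ∘ lookup X) ⟩
    sum {m} (λ _ → 1) + sum (bit ∘ lookup X)         ≡⟨ cong₂ _+_ (sum-ones m) (sym (card-sum X)) ⟩
    m + ∣ X ∣                                        ∎
    where
    open ≡-Reasoning
    pointwise : ∀ i → weight (kind J i) + bit (lookup Y i) ≡ 1 + bit (lookup X i)
    pointwise i rewrite kind≡ i with lookup X i in eq
    ... | true rewrite dis i eq = refl
    ... | false with lookup Y i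
    ...   | true  = refl
    ...   | false = refl

-- Rotations

module Rotation (m : ℕ) where

  private M = suc m

  open GroundSet M

  open Endo (Fin (M + M)) using (_^_)

  ρ-el : ∀ s (i : Fin M) → ρ M (el s i) ≡ el s (i ⊕ 1)
  ρ-el true  i rewrite Fin.splitAt-↑ˡ M i M = refl
  ρ-el false i rewrite Fin.splitAt-↑ʳ M M i = refl

  ρ^-el : ∀ q s (i : Fin M) → (ρ M ^ q) (el s i) ≡ el s (i ⊕ q)
  ρ^-el zero    s i = cong (el s) (sym (⊕-zero i))
  ρ^-el (suc q) s i = trans (cong (ρ M) (ρ^-el q s i)) (trans (ρ-el s (i ⊕ q)) (cong (el s) (⊕-suc i q)))

  ρ^-injective : ∀ {q} → q ≤ M → ∀ {x y} → (ρ M ^ q) x ≡ (ρ M ^ q) y → x ≡ y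
  ρ^-injective {q} q≤ {x} {y} eq with over? x | over? y
  ... | over s i | over s′ i′ with el-injective {s} {s′} (trans (sym (ρ^-el q s i))
        (trans eq (ρ^-el q s′ i′)))
  ... | refl , i⊕q≡i′⊕q = cong (el s) (⊕-injective q≤ i⊕q≡i′⊕q)

  ρ^-surjective : ∀ {q} → q ≤ M → ∀ y → ∃[ x ] (ρ M ^ q) x ≡ y
  ρ^-surjective {q} q≤ y with over? y
  ... | over s i = el s (i ⊕ (M ∸ q)) , trans (ρ^-el q s (i ⊕ (M ∸ q))) (cong (el s) (⊕-inverseˡ i q≤))

  kind-pull-ρ^ : ∀ q S i → kind (pull (ρ M ^ q) S) i ≡ kind S (i ⊕ q)
  kind-pull-ρ^ q S i = cong₂ mix (step true) (step false)
    where
    step : ∀ s → lookup (pull (ρ M ^ q) S) (el s i) ≡ lookup S (el s (i ⊕ q))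
    step s = trans (lookup-pull (ρ M ^ q) S (el s i)) (cong (lookup S) (ρ^-el q s i))

  card-pull-ρ^ : ∀ {q} → q ≤ M → ∀ S → ∣ pull (ρ M ^ q) S ∣ ≡ ∣ S ∣
  card-pull-ρ^ {q} q≤ S = begin
    ∣ pull (ρ M ^ q) S ∣                    ≡⟨ card-kind (pull (ρ M ^ q) S) ⟩
    sum (weight ∘ kind (pull (ρ M ^ q) S)) ≡⟨ sum-cong-≗ (λ i → cong weight (kind-pull-ρ^ q S i)) ⟩
    sum (λ i → weight (kind S (i ⊕ q)))    ≡⟨ sum-rotate q≤ (weight ∘ kind S) ⟩
    sum (weight ∘ kind S)                  ≡⟨ card-kind S ⟨
    ∣ S ∣                                   ∎
    where open ≡-Reasoning

  label≤ : (i : Fin M) → label i ≤ M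
  label≤ = Fin.toℕ<n

  ⟨⟩⁻ : ∀ {𝒜 S} → (⟨_⟩ M 𝒜) S → ∃[ i ] 𝒜 (pull (ρ M ^ label {M} i) S)
  ⟨⟩⁻ {𝒜} (i , R , R∈𝒜 , im) = i , subst 𝒜 (image⇒≡pull (ρ^-injective (label≤ i)) im) R∈𝒜

  ⟨⟩⁺ : ∀ {𝒜 S} i → 𝒜 (pull (ρ M ^ label {M} i) S) → (⟨_⟩ M 𝒜) S
  ⟨⟩⁺ {𝒜} {S} i pull∈𝒜 = i , _ , pull∈𝒜 , pull-image (ρ^-surjective (label≤ i)) S

  ⊆⟨⟩ : ∀ {𝒜 S} → 𝒜 S → (⟨_⟩ M 𝒜) S
  -- Labels run from 1 to `M`, so the trivial rotation occurs as the full turn, at the last index.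
  ⊆⟨⟩ {𝒜} {S} S∈𝒜 = ⟨⟩⁺ (fromℕ m) (subst 𝒜 (sym pull≡S) S∈𝒜)
    where
    pull≡S : pull (ρ M ^ label {M} (fromℕ m)) S ≡ S
    pull≡S = subset-ext step
      where
      step : ∀ x → lookup (pull (ρ M ^ label {M} (fromℕ m)) S) x ≡ lookup S x
      step x with over? x
      ... | over s i = trans (lookup-pull (ρ M ^ label (fromℕ m)) S (el s i))
            (cong (lookup S) (trans (ρ^-el (label {M} (fromℕ m)) s i)
              (cong (el s) (trans (cong (λ a → i ⊕ suc a) (Fin.toℕ-fromℕ m)) (⊕-period i)))))

  ⟨∣⟩⇒letter : ∀ {X Y S} → ⟨_∣_⟩ M X Y S → ∃[ q ] q ≤ M × (∀ i → kind S (i ⊕ q) ≡ letter X Y i)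
  ⟨∣⟩⇒letter {X} {Y} {S} S∈ = let (l , pull∈) = ⟨⟩⁻ {[_∣_] M X Y} S∈ in
    label {M} l , label≤ l , λ i → trans (sym (kind-pull-ρ^ (label {M} l) S i)) (bracket⇒kind {X} {Y} pull∈ i)

-- Resolutions

letter-cases : ∀ {m} (X Y : Subset m) i → letter X Y i ≡ 𝐱 ⊎ letter X Y i ≡ 𝐲 ⊎ letter X Y i ≡ 𝐳
letter-cases X Y i with lookup X i | lookup Y i
... | true  | _     = inj₁ refl
... | false | true  = inj₂ (inj₁ refl)
... | false | false = inj₂ (inj₂ refl)

-- At a letter other than `𝐳` both resolutions agree, and every further letter is determined by its
-- predecessor, so agreement spreads around the circle. Since `sgn` asks only for some resolution
-- with an odd count, uniqueness is what allows a symbol to be excluded from it.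
resolution-unique : ∀ {m} {X Y : Subset (suc m)} {d₁ d₂} →
                    IsResolution (string X Y) d₁ → IsResolution (string X Y) d₂ →
                    ∀ i → letter X Y i ≢ 𝐳 → d₁ ≡ d₂
resolution-unique {m} {X} {Y} {d₁} {d₂} res₁ res₂ i i≢𝐳 =
  trans (sym (tabulate∘lookup d₁)) (trans (tabulate-cong agree) (tabulate∘lookup d₂))
  where
  module R₁ = IsResolution res₁
  module R₂ = IsResolution res₂

  from-letter : ∀ {j s} → letter X Y j ≡ s → lookup (string X Y) j ≡ s
  from-letter {j} = trans (lookup-string X Y j)

  other-greek : ∀ {a b c} → a ≡ α ⊎ a ≡ β → b ≡ α ⊎ b ≡ β → a ≢ c → b ≢ c → c ≡ α ⊎ c ≡ β → a ≡ b
  other-greek (inj₁ refl) (inj₁ refl) _ _ _ = refl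
  other-greek (inj₂ refl) (inj₂ refl) _ _ _ = refl
  other-greek (inj₁ refl) (inj₂ refl) a≢c _ (inj₁ refl) = contradiction refl a≢c
  other-greek (inj₁ refl) (inj₂ refl) _ b≢c (inj₂ refl) = contradiction refl b≢c
  other-greek (inj₂ refl) (inj₁ refl) _ b≢c (inj₁ refl) = contradiction refl b≢c
  other-greek (inj₂ refl) (inj₁ refl) a≢c _ (inj₂ refl) = contradiction refl a≢c

  agree-suc : ∀ j → lookup d₁ j ≡ lookup d₂ j → lookup d₁ (j ⊕ 1) ≡ lookup d₂ (j ⊕ 1)
  agree-suc j eq with letter-cases X Y (j ⊕ 1)
  ... | inj₁ x        = trans (R₁.keep-x _ (from-letter x)) (sym (R₂.keep-x _ (from-letter x)))
  ... | inj₂ (inj₁ y) = trans (R₁.keep-y _ (from-letter y)) (sym (R₂.keep-y _ (from-letter y)))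
  ... | inj₂ (inj₂ z) with letter-cases X Y j
  ...   | inj₁ x        = trans (R₁.after-x j (from-letter z) (from-letter x))
        (sym (R₂.after-x j (from-letter z) (from-letter x)))
  ...   | inj₂ (inj₁ y) = trans (R₁.after-y j (from-letter z) (from-letter y))
        (sym (R₂.after-y j (from-letter z) (from-letter y)))
  ...   | inj₂ (inj₂ z′) = other-greek (R₁.greek _ (from-letter z)) (R₂.greek _ (from-letter z))
                             (R₁.differ j (from-letter z)) (λ eq′ → R₂.differ j (from-letter z)
                               (trans eq′ eq))
                             (R₁.greek j (from-letter z′))

  agree-from : ∀ t → lookup d₁ (i ⊕ t) ≡ lookup d₂ (i ⊕ t)
  agree-from zero rewrite ⊕-zero i with letter-cases X Y i
  ... | inj₁ x        = trans (R₁.keep-x i (from-letter x)) (sym (R₂.keep-x i (from-letter x)))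
  ... | inj₂ (inj₁ y) = trans (R₁.keep-y i (from-letter y)) (sym (R₂.keep-y i (from-letter y)))
  ... | inj₂ (inj₂ z) = contradiction z i≢𝐳
  agree-from (suc t) = subst (λ j → lookup d₁ j ≡ lookup d₂ j) (⊕-suc i t) (agree-suc (i ⊕ t) (agree-from t))

  agree : ∀ j → lookup d₁ j ≡ lookup d₂ j
  agree j with ⊕-reach i j
  ... | t , _ , refl = agree-from t

parity-suc : ∀ n → parity (suc n) ≡ parity n ⁻¹
parity-suc n = trans (sym (ℙ.⁻¹-involutive (parity (suc n)))) (cong _⁻¹ (ℙ.suc-homo-⁻¹ n))

bool-ext : ∀ {a b} → (a ≡ true → b ≡ true) → (b ≡ true → a ≡ true) → a ≡ b
bool-ext {true}  {b}     f _ = sym (f refl)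
bool-ext {false} {true}  _ g = g refl
bool-ext {false} {false} _ _ = refl

lookup-⊞1 : ∀ {m} (X : Subset (suc m)) i → lookup (X ⊞ 1) (i ⊕ 1) ≡ lookup X i
lookup-⊞1 X i = bool-ext
  (λ eq → let (x , x∈X , x⊕1≡i⊕1) = ∈-comprehension⁻ member? (∈-pred eq)
          in trans (cong (lookup X) (sym (⊕-injective (s≤s z≤n) x⊕1≡i⊕1))) ([]=⇒lookup x∈X))
  (λ eq → []=⇒lookup (∈-comprehension⁺ member? (i , ∈-pred eq , refl)))
  where
  member? = λ y → Fin.any? (λ x → (x ∈? X) ×-dec (x ⊕ 1 Fin.≟ y))

card-⊞1 : ∀ {m} (X : Subset (suc m)) → ∣ X ⊞ 1 ∣ ≡ ∣ X ∣
card-⊞1 X = begin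
  ∣ X ⊞ 1 ∣                               ≡⟨ card-sum (X ⊞ 1) ⟩
  sum (bit ∘ lookup (X ⊞ 1))              ≡⟨ sum-rotate (s≤s z≤n) (bit ∘ lookup (X ⊞ 1)) ⟨
  sum (λ i → bit (lookup (X ⊞ 1) (i ⊕ 1))) ≡⟨ sum-cong-≗ (λ i → cong bit (lookup-⊞1 X i)) ⟩
  sum (bit ∘ lookup X)                    ≡⟨ card-sum X ⟨
  ∣ X ∣                                   ∎
  where open ≡-Reasoning

-- Quotients

θ? : (I : Subset n) (x y : Fin n) → Dec (θ I x y)
θ? I x y = (x Fin.≟ y) ⊎-dec ((x ∈? I) ×-dec (y ∈? I))

-- The union of the classes that meet `S`, that is, the representative of its image in the quotient.
saturation : Subset n → Subset n → Subset n
saturation I S = comprehension (λ y → Fin.any? (λ x → (x ∈? S) ×-dec θ? I x y))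

saturation-image : (I S : Subset n) → IsImage (θ I) id S (saturation I S)
saturation-image I S y = mk⇔ (∈-comprehension⁻ member?) (∈-comprehension⁺ member?)
  where
  member? = λ y → Fin.any? (λ x → (x ∈? S) ×-dec θ? I x y)

-- The image of T in the quotient by θ I is included in that of S.
_≼[_]_ : Subset n → Subset n → Subset n → Set
T ≼[ I ] S = ∀ {x} → x ∈ T → ∃[ y ] y ∈ S × θ I y x

module Domination {n} (I : Subset n) (τ : Fin n → Fin n) (τ-involutive : ∀ x → τ (τ x) ≡ x)
  (τ-θ : ∀ {x y} → θ I x y → θ I (τ x) (τ y)) where

  open IsEquivalence (θ-isEquivalence I) using () renaming (trans to θ-trans)

  Dominates : SetSystem n → SetSystem n → Set
  Dominates ℬ 𝒜 = ∀ {S} → 𝒜 S → ∃[ T ] ℬ T × T ≼[ I ] pull τ S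

  saturated : ∀ {𝒜 S x y} → (𝒜 / I) S → θ I x y → x ∈ S → y ∈ S
  saturated {x = x} {y} (_ , _ , im) xy x∈S =
    let (x₀ , x₀∈ , x₀x) = Equivalence.to (im x) x∈S in Equivalence.from (im y) (x₀ , x₀∈ , θ-trans x₀x xy)

  τ-cancel : ∀ {S x} → τ (τ x) ∈ S → x ∈ S
  τ-cancel {S} {x} = subst (_∈ S) (τ-involutive x)

  dominating-block : ∀ {𝒜 ℬ} → Dominates ℬ 𝒜 → ∀ {S} → (𝒜 / I) S → ∃[ T ] (ℬ / I) T × T ⊆ pull τ S
  dominating-block dom (S₀ , S₀∈𝒜 , im) =
    let (T₀ , T₀∈ℬ , T₀≼) = dom S₀∈𝒜 in
    saturation I T₀ , (T₀ , T₀∈ℬ , saturation-image I T₀) , λ {y} y∈ →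
      let (x , x∈T₀ , xy) = Equivalence.to (saturation-image I T₀ y) y∈
          (x′ , x′∈ , x′x) = T₀≼ x∈T₀
      in ∈-pull⁺ τ (Equivalence.from (im (τ y)) (τ x′ , ∈-pull⁻ τ x′∈ , τ-θ (θ-trans x′x xy)))

  -- Going there and back: a `T` below `pull τ S` has in turn some `S′` below `pull τ T`, so `S′`
  -- lies in `S`. Minimality gives `S′ ≡ S`, and `T` is squeezed between equal sets.
  minimal-pull : ∀ {𝒜 ℬ} → Dominates ℬ 𝒜 → Dominates 𝒜 ℬ → ∀ {S} → (𝒜 /* I) S → (ℬ /* I) (pull τ S)
  minimal-pull {𝒜} {ℬ} ℬ≼𝒜 𝒜≼ℬ {S} (S∈ , S-min) =
    let (T , T∈ , T⊆) = dominating-block ℬ≼𝒜 S∈ in subst (ℬ / I) (unique T∈ T⊆) T∈ , unique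
    where
    unique : ∀ {T} → (ℬ / I) T → T ⊆ pull τ S → T ≡ pull τ S
    unique {T} T∈ T⊆ =
      let (S′ , S′∈ , S′⊆) = dominating-block 𝒜≼ℬ T∈
          S′≡S = S-min S′∈ (λ x∈S′ → τ-cancel (∈-pull⁻ τ (T⊆ (∈-pull⁻ τ (S′⊆ x∈S′)))))
      in ⊆-antisym T⊆ (λ x∈ → τ-cancel (∈-pull⁻ τ (S′⊆ (subst (_ ∈_) (sym S′≡S) (∈-pull⁻ τ x∈)))))

  isomorphic : ∀ {𝒜 ℬ} → Dominates ℬ 𝒜 → Dominates 𝒜 ℬ → Isomorphic (θ I) (θ I) (𝒜 /* I) (ℬ /* I)
  isomorphic {𝒜} {ℬ} ℬ≼𝒜 𝒜≼ℬ = τ , bijection , to , from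
    where
    bijection : IsBijection (θ I) (θ I) τ
    bijection = record
      { isInjection = record
        { isCongruent = record
          { cong           = τ-θ
          ; isEquivalence₁ = θ-isEquivalence I
          ; isEquivalence₂ = θ-isEquivalence I
          }
        ; injective = λ {x} {y} τxτy → subst₂ (θ I) (τ-involutive x) (τ-involutive y) (τ-θ τxτy)
        }
      ; surjective = λ y → τ y , λ {x} xτy → subst (θ I (τ x)) (τ-involutive y) (τ-θ xτy)
      }

    -- `IsImage` meets elements only up to `θ I`; that `S` is a union of classes turns this into an
    -- equality of subsets.
    image≡pull : ∀ {S T} → (𝒜 / I) S → IsImage (θ I) τ S T → T ≡ pull τ S
    image≡pull {S} {T} S∈ im = ⊆-antisym
      (λ {y} y∈T → let (x , x∈S , τxy) = Equivalence.to (im y) y∈T in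
        ∈-pull⁺ τ (saturated {𝒜} S∈ (subst (λ z → θ I z (τ y)) (τ-involutive x) (τ-θ τxy)) x∈S))
      (λ {y} y∈ → Equivalence.from (im y) (τ y , ∈-pull⁻ τ y∈ , inj₁ (τ-involutive y)))

    to : ∀ {T} → Image (θ I) τ (𝒜 /* I) T → (ℬ /* I) T
    to (S , S∈ , im) = subst (ℬ /* I) (sym (image≡pull (proj₁ S∈) im)) (minimal-pull ℬ≼𝒜 𝒜≼ℬ S∈)

    from : ∀ {T} → (ℬ /* I) T → Image (θ I) τ (𝒜 /* I) T
    from {T} T∈ = pull τ T , minimal-pull 𝒜≼ℬ ℬ≼𝒜 T∈ , λ y → mk⇔
      (λ y∈T → τ y , ∈-pull⁺ τ (subst (_∈ T) (sym (τ-involutive y)) y∈T) , inj₁ (τ-involutive y))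
      (λ (x , x∈ , τxy) → saturated {ℬ} (proj₁ T∈) τxy (∈-pull⁻ τ x∈))

pair-members : (I : Subset n) → ∣ I ∣ ≡ 2 → ∃₂ λ a b → a ≢ b × a ∈ I × b ∈ I × (∀ {x} → x ∈ I → x ≡ a ⊎ x ≡ b)
pair-members I ∣I∣≡2 = two I ∣I∣≡2
  where
  none : (I : Subset n) → ∣ I ∣ ≡ 0 → ∀ {x} → x ∉ I
  none (false ∷ I) eq (there x∈) = none I eq x∈
  one : (I : Subset n) → ∣ I ∣ ≡ 1 → ∃[ a ] a ∈ I × (∀ {x} → x ∈ I → x ≡ a)
  one (true  ∷ I) eq = zero , here , λ { here → refl ; (there x∈) → contradiction x∈
      (none I (ℕ.suc-injective eq)) }
  one (false ∷ I) eq = let (a , a∈ , only) = one I eq in suc a , there a∈ , λ { (there x∈) → cong suc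
      (only x∈) }
  two : (I : Subset n) → ∣ I ∣ ≡ 2 → ∃₂ λ a b → a ≢ b × a ∈ I × b ∈ I × (∀ {x} → x ∈ I → x ≡ a ⊎ x ≡ b)
  two (true  ∷ I) eq = let (a , a∈ , only) = one I (ℕ.suc-injective eq) in
    zero , suc a , (λ ()) , here , there a∈ , λ { here → inj₁ refl ; (there x∈) → inj₂ (cong suc (only x∈)) }
  two (false ∷ I) eq = let (a , b , a≢b , a∈ , b∈ , only) = two I eq in
    suc a , suc b , a≢b ∘ Fin.suc-injective , there a∈ , there b∈ ,
    λ { (there x∈) → Sum.map (cong suc) (cong suc) (only x∈) }

-- Exchanging elements

card-add : (S : Subset n) (x : Fin n) → lookup S x ≡ false → ∣ S [ x ]≔ true ∣ ≡ suc ∣ S ∣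
card-add (false ∷ S) zero    eq = refl
card-add (true  ∷ S) (suc x) eq = cong suc (card-add S x eq)
card-add (false ∷ S) (suc x) eq = card-add S x eq

card-remove : (S : Subset n) (x : Fin n) → lookup S x ≡ true → suc ∣ S [ x ]≔ false ∣ ≡ ∣ S ∣
card-remove (true  ∷ S) zero    eq = refl
card-remove (true  ∷ S) (suc x) eq = cong suc (card-remove S x eq)
card-remove (false ∷ S) (suc x) eq = card-remove S x eq

exchange : Subset n → Fin n → Fin n → Subset n
exchange S κ w = (S [ w ]≔ true) [ κ ]≔ false

module _ {S : Subset n} {κ w : Fin n} where

  lookup-exchange-out : lookup (exchange S κ w) κ ≡ false
  lookup-exchange-out = lookup∘updateAt κ (S [ w ]≔ true)

  lookup-exchange-in : w ≢ κ → lookup (exchange S κ w) w ≡ true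
  lookup-exchange-in w≢κ = trans (lookup∘updateAt′ w κ w≢κ (S [ w ]≔ true)) (lookup∘updateAt w S)

  lookup-exchange-other : ∀ {x} → x ≢ κ → x ≢ w → lookup (exchange S κ w) x ≡ lookup S x
  lookup-exchange-other {x} x≢κ x≢w =
    trans (lookup∘updateAt′ x κ x≢κ (S [ w ]≔ true)) (lookup∘updateAt′ x w x≢w S)

  card-exchange : lookup S κ ≡ true → lookup S w ≡ false → ∣ exchange S κ w ∣ ≡ ∣ S ∣
  card-exchange κ∈ w∉ = ℕ.suc-injective (trans
    (card-remove (S [ w ]≔ true) κ (trans (lookup∘updateAt′ κ w κ≢w S) κ∈)) (card-add S w w∉))
    where
    κ≢w : κ ≢ w
    κ≢w refl with () ← trans (sym κ∈) w∉

  -- The only new element `w` is in the class of `v`, which `S` already contains, so the image in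
  -- the quotient does not grow.
  exchange-≼ : ∀ {I v} → v ∈ I → w ∈ I → v ∈ S → exchange S κ w ≼[ I ] S
  exchange-≼ {I} {v} v∈I w∈I v∈S {x} x∈ with x Fin.≟ w | x Fin.≟ κ
  ... | yes refl | _        = v , v∈S , inj₂ (v∈I , w∈I)
  ... | no  _    | yes refl = contradiction x∈ (false⇒∉ lookup-exchange-out)
  ... | no  x≢w  | no  x≢κ  = x , ∈-pred (trans (sym (lookup-exchange-other x≢κ x≢w))
        ([]=⇒lookup x∈)) , inj₁ refl

parity-flip : (J J′ : Subset n) (k : Fin n) → lookup J′ k ≡ not (lookup J k) →
              (∀ i → i ≢ k → lookup J′ i ≡ lookup J i) → parity ∣ J′ ∣ ≡ parity ∣ J ∣ ⁻¹
parity-flip (b ∷ J) (b′ ∷ J′) zero at off with refl ← subset-ext {S = J′} {J}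
    (λ i → off (suc i) λ ()) with b | b′ | at
... | true  | false | refl = sym (ℙ.suc-homo-⁻¹ ∣ J ∣)
... | false | true  | refl = parity-suc ∣ J ∣
parity-flip (b ∷ J) (b′ ∷ J′) (suc k) at off with refl ← off zero (λ ()) with b
... | false = parity-flip J J′ k at (λ i i≢k → off (suc i) (i≢k ∘ Fin.suc-injective))
... | true  = trans (parity-suc ∣ J′ ∣) (trans (cong _⁻¹ (parity-flip J J′ k at
      (λ i i≢k → off (suc i) (i≢k ∘ Fin.suc-injective))))
                (cong _⁻¹ (sym (parity-suc ∣ J ∣))))

module Systems (n : ℕ) (n-even : Even n) where

  M : ℕ
  M = 3 + n

  1+n-odd : parity (suc n) ≡ 1ℙ
  1+n-odd = trans (parity-suc n) (cong _⁻¹ n-even)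

  open GroundSet M
  open Rotation (2 + n)
  open Endo (Fin (M + M)) using (_^_)

  -- The words of `A` and `B`

  col : Parity → Symbol
  col 0ℙ = 𝐲
  col 1ℙ = 𝐱

  -- The words of the rotations of A (ε = 0ℙ) and B (ε = 1ℙ) whose only 𝐳 is at k.
  Alternating : (Fin M → Symbol) → Fin M → Parity → Set
  Alternating f k ε = f k ≡ 𝐳 × (∀ t → t < 2 + n → f (k ⊕ suc t) ≡ col (ε ℙ.+ parity t))

  around : ∀ k i → i ≡ k ⊎ ∃[ t ] t < 2 + n × i ≡ k ⊕ suc t
  around k i with ⊕-reach k i
  ... | zero  , _       , eq = inj₁ (trans eq (⊕-zero k))
  ... | suc t , s≤s t<  , eq = inj₂ (t , t< , eq)

  alternating-pull : ∀ {q k ε T} → Alternating (kind (pull (ρ M ^ q) T)) k ε → Alternating (kind T) (k ⊕ q) ε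
  alternating-pull {q} {k} {ε} {T} (at-k , off-k) =
    trans (sym (kind-pull-ρ^ q T k)) at-k ,
    λ t t< → trans (cong (kind T) (⊕-comm k q (suc t))) (trans (sym (kind-pull-ρ^ q T (k ⊕ suc t)))
        (off-k t t<))

  lastᶠ : Fin M
  lastᶠ = fromℕ (2 + n)

  toℕ-lastᶠ⊕ : ∀ {t} → t < M → toℕ (lastᶠ ⊕ suc t) ≡ t
  toℕ-lastᶠ⊕ {t} t< = begin
    toℕ (lastᶠ ⊕ suc t)       ≡⟨ toℕ-⊕ lastᶠ (suc t) ⟩
    (toℕ lastᶠ + suc t) % M   ≡⟨ cong (λ a → (a + suc t) % M) (Fin.toℕ-fromℕ (2 + n)) ⟩
    (2 + n + suc t) % M       ≡⟨ cong (_% M) (trans (ℕ.+-suc (2 + n) t) (ℕ.+-comm M t)) ⟩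
    (t + M) % M               ≡⟨ [m+n]%n≡m%n t M ⟩
    t % M                     ≡⟨ m<n⇒m%n≡m t< ⟩
    t                         ∎
    where open ≡-Reasoning

  even? : Parity → Bool
  even? 0ℙ = true
  even? 1ℙ = false

  inC : ℕ → Bool
  inC t = does (parity (suc t) ℙ.≟ 1ℙ) ∧ does (suc t ℕ.≤? suc n)

  lookup-C : ∀ i → lookup (C M) i ≡ inC (toℕ i)
  lookup-C = lookup∘tabulate (inC ∘ toℕ)

  -- Here `t` is the label minus 1, so odd labels are even `t`. The bound m - 2 on labels is
  -- automatic for even `t` in this range, because the largest value `1 + n` of `t` is odd.
  inC≡even? : ∀ t → t < 2 + n → inC t ≡ even? (parity t)
  inC≡even? t (s≤s t≤1+n) rewrite parity-suc t with parity t in eq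
  ... | 1ℙ = refl
  ... | 0ℙ = dec-true (suc t ℕ.≤? suc n) (s≤s (ℕ.≤-pred (ℕ.≤∧≢⇒< t≤1+n t≢1+n)))
    where
    t≢1+n : t ≢ suc n
    t≢1+n refl with () ← trans (sym eq) 1+n-odd

  inC-last : inC (2 + n) ≡ false
  inC-last rewrite parity-suc n | n-even = dec-false (3 + n ℕ.≤? suc n)
      (λ 3+n≤1+n → ℕ.1+n≰n (ℕ.≤-trans (ℕ.n≤1+n _) 3+n≤1+n))

  lookup-C-last : lookup (C M) lastᶠ ≡ false
  lookup-C-last = trans (lookup-C lastᶠ) (trans (cong inC (Fin.toℕ-fromℕ (2 + n))) inC-last)

  lookup-C-suc : ∀ t → t < 2 + n → lookup (C M) (lastᶠ ⊕ suc t) ≡ even? (parity t)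
  lookup-C-suc t t< = trans (lookup-C (lastᶠ ⊕ suc t)) (trans (cong inC (toℕ-lastᶠ⊕ (ℕ.m<n⇒m<1+n t<)))
      (inC≡even? t t<))

  lookup-C⊞1-last : lookup (C M ⊞ 1) lastᶠ ≡ false
  lookup-C⊞1-last = begin
    lookup (C M ⊞ 1) lastᶠ                      ≡⟨ cong (lookup (C M ⊞ 1))
        (trans (⊕-suc lastᶠ (2 + n)) (⊕-period lastᶠ)) ⟨
    lookup (C M ⊞ 1) (lastᶠ ⊕ (2 + n) ⊕ 1)      ≡⟨ lookup-⊞1 (C M) (lastᶠ ⊕ (2 + n)) ⟩
    lookup (C M) (lastᶠ ⊕ (2 + n))              ≡⟨ lookup-C-suc (1 + n) ℕ.≤-refl ⟩
    even? (parity (suc n))                      ≡⟨ cong even? 1+n-odd ⟩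
    false                                       ∎
    where open ≡-Reasoning

  lookup-C⊞1-suc : ∀ t → t < 2 + n → lookup (C M ⊞ 1) (lastᶠ ⊕ suc t) ≡ even? (parity t ⁻¹)
  lookup-C⊞1-suc t t< = trans (cong (lookup (C M ⊞ 1)) (sym (⊕-suc lastᶠ t)))
      (trans (lookup-⊞1 (C M) (lastᶠ ⊕ t)) (step t t<))
    where
    step : ∀ t → t < 2 + n → lookup (C M) (lastᶠ ⊕ t) ≡ even? (parity t ⁻¹)
    step zero    _  = trans (cong (lookup (C M)) (⊕-zero lastᶠ)) lookup-C-last
    step (suc t) t< = trans (lookup-C-suc t (ℕ.<-trans (ℕ.n<1+n t) t<)) (cong even? (sym (ℙ.suc-homo-⁻¹ t)))

  alternating-C∣C⊞1 : Alternating (letter (C M) (C M ⊞ 1)) lastᶠ 1ℙ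
  alternating-C∣C⊞1 = cong₂ pick lookup-C-last lookup-C⊞1-last ,
    λ t t< → trans (cong₂ pick (lookup-C-suc t t<) (lookup-C⊞1-suc t t<)) (helper (parity t))
    where
    helper : ∀ p → pick (even? p) (even? (p ⁻¹)) ≡ col (p ⁻¹)
    helper 0ℙ = refl
    helper 1ℙ = refl

  alternating-C⊞1∣C : Alternating (letter (C M ⊞ 1) (C M)) lastᶠ 0ℙ
  alternating-C⊞1∣C = cong₂ pick lookup-C⊞1-last lookup-C-last ,
    λ t t< → trans (cong₂ pick (lookup-C⊞1-suc t t<) (lookup-C-suc t t<)) (helper (parity t))
    where
    helper : ∀ p → pick (even? (p ⁻¹)) (even? p) ≡ col p
    helper 0ℙ = refl
    helper 1ℙ = refl

  disjoint-C-C⊞1 : ∀ i → lookup (C M) i ≡ true → lookup (C M ⊞ 1) i ≡ false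
  disjoint-C-C⊞1 i i∈C with around lastᶠ i
  ... | inj₁ refl = lookup-C⊞1-last
  ... | inj₂ (t , t< , refl) = trans (lookup-C⊞1-suc t t<) (helper (parity t)
        (trans (sym (lookup-C-suc t t<)) i∈C))
    where
    helper : ∀ p → even? p ≡ true → even? (p ⁻¹) ≡ false
    helper 0ℙ _ = refl

  disjoint-sym : {X Y : Subset M} → Disjoint X Y → Disjoint Y X
  disjoint-sym {X} dis i i∈Y with lookup X i in eq
  ... | false = refl
  ... | true  with () ← trans (sym i∈Y) (dis i eq)

  lookup-last : lookup (last M) lastᶠ ≡ true
  lookup-last = trans (lookup∘tabulate (λ i → does (label i ℕ.≟ M)) lastᶠ)
      (dec-true (label lastᶠ ℕ.≟ M) (cong suc (Fin.toℕ-fromℕ (2 + n))))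

  lookup-last-suc : ∀ t → t < 2 + n → lookup (last M) (lastᶠ ⊕ suc t) ≡ false
  lookup-last-suc t t< = trans (lookup∘tabulate (λ i → does (label i ℕ.≟ M)) (lastᶠ ⊕ suc t))
      (dec-false (label (lastᶠ ⊕ suc t) ℕ.≟ M)
    λ eq → ℕ.<⇒≢ t< (trans (sym (toℕ-lastᶠ⊕ (ℕ.m<n⇒m<1+n t<))) (ℕ.suc-injective eq)))

  -- The common shape of `A` and `B`. Away from the last index both copies are present or neither
  -- is, and since the word of the pair has no `𝐳` there, absence from `X` means membership in `Y`.
  -- At the last index only the unprimed copy is supplied.
  kind-last∪X++X : {X Y : Subset M} {ε : Parity} → Alternating (letter X Y) lastᶠ ε →
                   ∀ i → kind ((last M ∪ X) ++ X) i ≡ letter X Y i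
  kind-last∪X++X {X} {Y} {ε} (at-last , off-last) i =
    trans (cong₂ mix (trans (lookup-++ˡ (last M ∪ X) X i) (lookup-zipWith _∨_ i (last M) X))
        (lookup-++ʳ (last M ∪ X) X i))
          (step (around lastᶠ i))
    where
    at : ∀ a b → pick a b ≡ 𝐳 → mix true a ≡ 𝐳
    at false false _ = refl
    at true  _     ()
    at false true  ()
    off : ∀ a b p → pick a b ≡ col p → mix a a ≡ pick a b
    off true  _     _  _ = refl
    off false true  _  _ = refl
    off false false 0ℙ ()
    off false false 1ℙ ()
    step : i ≡ lastᶠ ⊎ (∃[ t ] t < 2 + n × i ≡ lastᶠ ⊕ suc t) →
           mix (lookup (last M) i ∨ lookup X i) (lookup X i) ≡ letter X Y i
    step (inj₁ refl) rewrite lookup-last = trans (at (lookup X lastᶠ) _ at-last) (sym at-last)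
    step (inj₂ (t , t< , refl)) rewrite lookup-last-suc t t< = off (lookup X i) _ _ (off-last t t<)

  kind-A : ∀ i → kind (A M) i ≡ letter (C M ⊞ 1) (C M) i
  kind-A = kind-last∪X++X {C M ⊞ 1} {C M} {0ℙ} alternating-C⊞1∣C

  kind-B : ∀ i → kind (B M) i ≡ letter (C M) (C M ⊞ 1) i
  kind-B = kind-last∪X++X {C M} {C M ⊞ 1} {1ℙ} alternating-C∣C⊞1

  card-A : ∣ A M ∣ ≡ M
  card-A = ℕ.+-cancelʳ-≡ ∣ C M ∣ _ _ (trans (kind⇒card {X = C M ⊞ 1} {C M} {A M}
      (disjoint-sym {C M} {C M ⊞ 1} disjoint-C-C⊞1) kind-A) (cong (M +_) (card-⊞1 (C M))))

  card-B : ∣ B M ∣ ≡ M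
  card-B = ℕ.+-cancelʳ-≡ ∣ C M ⊞ 1 ∣ _ _ (trans (kind⇒card {X = C M} {C M ⊞ 1} {B M} disjoint-C-C⊞1 kind-B)
      (cong (M +_) (sym (card-⊞1 (C M)))))

  alternating-cong : ∀ {f g k ε} → (∀ i → f i ≡ g i) → Alternating g k ε → Alternating f k ε
  alternating-cong f≗g (at-k , off-k) = trans (f≗g _) at-k , λ t t< → trans (f≗g _) (off-k t t<)

  ⟨∣⟩⇒alternating : ∀ {X Y ε S} → Alternating (letter X Y) lastᶠ ε → ⟨_∣_⟩ M X Y S →
                    ∃[ k ] Alternating (kind S) k ε
  ⟨∣⟩⇒alternating {X} {Y} {ε} {S} alt S∈ with ⟨⟩⁻ {[_∣_] M X Y} S∈
  ... | i , pull∈ = lastᶠ ⊕ label {M} i , alternating-pull {label {M} i} {lastᶠ} {ε} {S}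
        (alternating-cong {ε = ε} (bracket⇒kind {X} {Y} pull∈) alt)

  -- Signatures and membership in `ℋ`

  ⊕-distinct : ∀ (i : Fin M) {p q} → p < M → q < M → p ≢ q → i ⊕ p ≢ i ⊕ q
  ⊕-distinct i p< q< p≢q eq = p≢q (⊕-cancelˡ i p< q< eq)

  -- The pair whose bracket contains `T`, read off from `T`, so that membership in `ℋ` becomes a
  -- question about the word of `T` alone.
  both neither : Subset (M + M) → Subset M
  both    T = tabulate (λ i → lookup T (el true i) ∧ lookup T (el false i))
  neither T = tabulate (λ i → not (lookup T (el true i) ∨ lookup T (el false i)))

  lookup-both : ∀ T i → lookup (both T) i ≡ lookup T (el true i) ∧ lookup T (el false i)
  lookup-both T = lookup∘tabulate (λ i → lookup T (el true i) ∧ lookup T (el false i))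

  lookup-neither : ∀ T i → lookup (neither T) i ≡ not (lookup T (el true i) ∨ lookup T (el false i))
  lookup-neither T = lookup∘tabulate (λ i → not (lookup T (el true i) ∨ lookup T (el false i)))

  kind≡letter : ∀ T i → kind T i ≡ letter (both T) (neither T) i
  kind≡letter T i rewrite lookup-both T i | lookup-neither T i = helper (lookup T (el true i))
      (lookup T (el false i))
    where
    helper : ∀ a b → mix a b ≡ pick (a ∧ b) (not (a ∨ b))
    helper true  true  = refl
    helper true  false = refl
    helper false true  = refl
    helper false false = refl

  both-neither-disjoint : ∀ T → Disjoint (both T) (neither T)
  both-neither-disjoint T i rewrite lookup-both T i | lookup-neither T i = helper (lookup T (el true i))
      (lookup T (el false i))
    where
    helper : ∀ a b → a ∧ b ≡ true → not (a ∨ b) ≡ false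
    helper true true _ = refl

  ∈-own-bracket : ∀ T → [_∣_] M (both T) (neither T) T
  ∈-own-bracket T = kind⇒bracket {both T} {neither T} {T} (both-neither-disjoint T) (kind≡letter T)

  card-both≡neither : ∀ T → ∣ T ∣ ≡ M → ∣ both T ∣ ≡ ∣ neither T ∣
  card-both≡neither T ∣T∣≡M = sym (ℕ.+-cancelˡ-≡ M _ _
    (trans (cong (_+ ∣ neither T ∣) (sym ∣T∣≡M)) (kind⇒card {both T} {neither T} {T}
      (both-neither-disjoint T) (kind≡letter T))))

  ⟨⊥∣⊥⟩⇒𝐳 : ∀ S → ⟨_∣_⟩ M ⊥ ⊥ S → ∀ i → kind S i ≡ 𝐳
  ⟨⊥∣⊥⟩⇒𝐳 S S∈ i = let (q , q≤ , kind≡) = ⟨∣⟩⇒letter {⊥} {⊥} {S} S∈ in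
    trans (cong (kind S) (sym (⊕-inverseˡ i q≤)))
      (trans (kind≡ (i ⊕ (M ∸ q))) (cong (λ b → pick b b) (lookup-replicate (i ⊕ (M ∸ q)) false)))

  alternating-𝐳 : ∀ {f k} ε → Alternating f k ε → ∀ i → f i ≡ 𝐳 → i ≡ k
  alternating-𝐳 {f} {k} ε (_ , off-k) i z with around k i
  ... | inj₁ i≡k = i≡k
  ... | inj₂ (t , t< , refl) = contradiction (trans (sym z) (off-k t t<)) (𝐳≢col (ε ℙ.+ parity t))
    where
    𝐳≢col : ∀ p → 𝐳 ≢ col p
    𝐳≢col 0ℙ ()
    𝐳≢col 1ℙ ()

  -- In the words of ⟨C+1|C⟩ the `𝐳` is followed by `𝐲`; in those of ⟨C|C+1⟩ it is preceded by `𝐲`,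
  -- as `alternating-before` says. A `𝐳` with no `𝐲` next to it thus certifies that a set belongs to
  -- neither excluded family.
  alternating-after : ∀ {f k} → Alternating f k 0ℙ → ∀ i → f i ≡ 𝐳 → f (i ⊕ 1) ≡ 𝐲
  alternating-after {f} {k} alt i z =
    trans (cong (λ j → f (j ⊕ 1)) (alternating-𝐳 {f} {k} 0ℙ alt i z)) (proj₂ alt 0 (s≤s z≤n))

  alternating-before : ∀ {f k} → Alternating f k 1ℙ → ∀ i → f (i ⊕ 1) ≡ 𝐳 → f i ≡ 𝐲
  alternating-before {f} {k} alt i z = begin
    f i                         ≡⟨ cong f (trans (⊕-assoc i 1 (2 + n)) (⊕-period i)) ⟨
    f (i ⊕ 1 ⊕ suc (1 + n))     ≡⟨ cong (λ j → f (j ⊕ suc (1 + n))) (alternating-𝐳 {f} {k} 1ℙ alt (i ⊕ 1) z) ⟩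
    f (k ⊕ suc (1 + n))         ≡⟨ proj₂ alt (1 + n) ℕ.≤-refl ⟩
    col (1ℙ ℙ.+ parity (suc n)) ≡⟨ cong (λ p → col (1ℙ ℙ.+ p)) 1+n-odd ⟩
    𝐲                           ∎
    where open ≡-Reasoning

  -- The resolution has β at e and α at the other 𝐳; their total number is odd, because m is odd
  -- and 𝐱, 𝐲 occur equally often.
  module Membership (T : Subset (M + M)) (e′ : Fin M)
    (at-e : kind T (e′ ⊕ 1) ≡ 𝐳) (before : kind T e′ ≢ 𝐲) (after : kind T (e′ ⊕ 1 ⊕ 1) ≢ 𝐲)
    (others : ∀ i → kind T (i ⊕ 1) ≡ 𝐳 → i ≢ e′ → kind T i ≡ 𝐲 ⊎ i ≡ e′ ⊕ 1)
    (size : ∣ T ∣ ≡ M) where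

    e : Fin M
    e = e′ ⊕ 1

    X Y : Subset M
    X = both T
    Y = neither T

    greek : Bool → Symbol → Symbol
    greek true  _ = β
    greek false 𝐳 = α
    greek false s = s

    g : Fin M → Symbol
    g i = greek (does (i Fin.≟ e)) (kind T i)

    d′ : Vec Symbol M
    d′ = tabulate g

    e⊕1≢e : e ⊕ 1 ≢ e
    e⊕1≢e eq = ⊕-distinct e′ {2} {1} (s≤s (s≤s (s≤s z≤n))) (s≤s (s≤s z≤n)) (λ ())
        (trans (sym (⊕-suc e′ 1)) eq)

    e⊕1≢e′ : e ⊕ 1 ≢ e′
    e⊕1≢e′ eq = ⊕-distinct e′ {2} {0} (s≤s (s≤s (s≤s z≤n))) (s≤s z≤n) (λ ())
      (trans (sym (⊕-suc e′ 1)) (trans eq (sym (⊕-zero e′))))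

    e′≢e : e′ ≢ e
    e′≢e eq = ⊕-distinct e′ {0} {1} (s≤s z≤n) (s≤s (s≤s z≤n)) (λ ()) (trans (⊕-zero e′) eq)

    -- If this letter were `𝐳`, its predecessor at `e ⊕ 1` would have to be `𝐲`, against `after`, or
    -- have the index `e`. The index serves twice: as the starting point for uniqueness of the
    -- resolution and to tell `T` from the members of ⟨∅|∅⟩.
    non-𝐳 : kind T (e ⊕ 1 ⊕ 1) ≢ 𝐳
    non-𝐳 z with others (e ⊕ 1) z e⊕1≢e′
    ... | inj₁ y  = after y
    ... | inj₂ eq = e⊕1≢e eq

    g-at : g e ≡ β
    g-at = cong (λ b → greek b (kind T e)) (dec-true (e Fin.≟ e) refl)

    g-off : ∀ {i} → i ≢ e → g i ≡ greek false (kind T i)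
    g-off {i} i≢e = cong (λ b → greek b (kind T i)) (dec-false (i Fin.≟ e) i≢e)

    string-kind : ∀ {i s} → lookup (string X Y) i ≡ s → kind T i ≡ s
    string-kind {i} eq = trans (kind≡letter T i) (trans (sym (lookup-string X Y i)) eq)

    d′-g : ∀ {i s} → g i ≡ s → lookup d′ i ≡ s
    d′-g {i} = trans (lookup∘tabulate g i)

    keeps : ∀ {i s} → s ≢ 𝐳 → lookup (string X Y) i ≡ s → lookup d′ i ≡ greek false s
    keeps {i} {s} s≢𝐳 eq = d′-g (trans (g-off i≢e) (cong (greek false) (string-kind eq)))
      where
      i≢e : i ≢ e
      i≢e refl = s≢𝐳 (trans (sym (string-kind eq)) at-e)

    g-𝐳 : ∀ {i} → i ≢ e → kind T i ≡ 𝐳 → g i ≡ α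
    g-𝐳 i≢e z = trans (g-off i≢e) (cong (greek false) z)

    resolution : IsResolution (string X Y) d′
    resolution = record
      { keep-x  = λ i → keeps {i} {𝐱} λ ()
      ; keep-y  = λ i → keeps {i} {𝐲} λ ()
      ; greek   = λ i z → greek-𝐳 i (string-kind z)
      ; differ  = λ i z → differ i (string-kind z)
      ; after-x = λ i z x → after-x i (string-kind z) (string-kind x)
      ; after-y = λ i z y → after-y i (string-kind z) (string-kind y)
      }
      where
      greek-𝐳 : ∀ i → kind T i ≡ 𝐳 → lookup d′ i ≡ α ⊎ lookup d′ i ≡ β
      greek-𝐳 i z with i Fin.≟ e
      ... | yes refl = inj₂ (d′-g g-at)
      ... | no i≢e   = inj₁ (d′-g (g-𝐳 i≢e z))

      ⊕1≢e : ∀ {i} → i ≢ e′ → i ⊕ 1 ≢ e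
      ⊕1≢e i≢e′ eq = i≢e′ (⊕-injective (s≤s z≤n) eq)

      ≢β : ∀ a b → β ≢ greek false (mix a b)
      ≢β true  true  ()
      ≢β false false ()
      ≢β true  false ()
      ≢β false true  ()

      -- By `others`, a `𝐳` away from `e` follows either a `𝐲` or the `β` at `e`, so its `α` never
      -- repeats the preceding symbol. The `β` at `e` does not either, as `β` occurs nowhere else.
      differ : ∀ i → kind T (i ⊕ 1) ≡ 𝐳 → lookup d′ (i ⊕ 1) ≢ lookup d′ i
      differ i z eq with i Fin.≟ e′
      ... | yes refl = ≢β (lookup T (el true e′)) (lookup T (el false e′))
            (trans (sym (d′-g g-at)) (trans eq (d′-g (g-off e′≢e))))
      differ i z eq | no i≢e′ with others i z i≢e′ | i Fin.≟ e
      ...   | inj₂ refl | no i≢e   = i≢e refl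
      ...   | _         | yes refl with () ← trans (sym (d′-g (g-𝐳 (⊕1≢e i≢e′) z))) (trans eq (d′-g g-at))
      ...   | inj₁ y    | no i≢e   with () ← trans (sym (d′-g (g-𝐳 (⊕1≢e i≢e′) z)))
            (trans eq (d′-g (trans (g-off i≢e) (cong (greek false) y))))

      after-x : ∀ i → kind T (i ⊕ 1) ≡ 𝐳 → kind T i ≡ 𝐱 → lookup d′ (i ⊕ 1) ≡ β
      after-x i z x with i Fin.≟ e′
      ... | yes refl = d′-g g-at
      ... | no i≢e′ with others i z i≢e′
      ...   | inj₁ y    with () ← trans (sym x) y
      ...   | inj₂ refl with () ← trans (sym x) at-e

      after-y : ∀ i → kind T (i ⊕ 1) ≡ 𝐳 → kind T i ≡ 𝐲 → lookup d′ (i ⊕ 1) ≡ α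
      after-y i z y with i Fin.≟ e′
      ... | yes refl = contradiction y before
      ... | no i≢e′  = d′-g (g-𝐳 (⊕1≢e i≢e′) z)

    indicator : Symbol → Symbol → ℕ
    indicator a s = bit (does (s ≟ˢ a))

    count-d′ : ∀ a → count (_≟ˢ a) d′ ≡ sum (indicator a ∘ g)
    count-d′ a = trans (count-sum (_≟ˢ a) d′) (sum-cong-≗ (λ i → cong (indicator a) (lookup∘tabulate g i)))

    count-β : count (_≟ˢ β) d′ ≡ 1
    count-β = trans (count-d′ β) (sum-point (indicator β ∘ g) e (cong (indicator β) g-at)
      (λ i i≢e → trans (cong (indicator β) (g-off i≢e)) (helper (lookup T (el true i))
        (lookup T (el false i)))))
      where
      helper : ∀ a b → indicator β (greek false (mix a b)) ≡ 0
      helper true  true  = refl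
      helper true  false = refl
      helper false true  = refl
      helper false false = refl

    count-all : count (_≟ˢ α) d′ + 1 + (∣ X ∣ + ∣ X ∣) ≡ M
    count-all = begin
      count (_≟ˢ α) d′ + 1 + (∣ X ∣ + ∣ X ∣)
        ≡⟨ cong₂ (λ a b → count (_≟ˢ α) d′ + a + (∣ X ∣ + b)) (sym count-β) (card-both≡neither T size) ⟩
      count (_≟ˢ α) d′ + count (_≟ˢ β) d′ + (∣ X ∣ + ∣ Y ∣)
        ≡⟨ cong₂ _+_ (cong₂ _+_ (count-d′ α) (count-d′ β)) (cong₂ _+_ (card-sum X) (card-sum Y)) ⟩
      sum (indicator α ∘ g) + sum (indicator β ∘ g) + (sum (bit ∘ lookup X) + sum (bit ∘ lookup Y))
        ≡⟨ cong₂ _+_ (∑-distrib-+ (indicator α ∘ g) (indicator β ∘ g))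
            (∑-distrib-+ (bit ∘ lookup X) (bit ∘ lookup Y)) ⟨
      sum (λ i → indicator α (g i) + indicator β (g i)) + sum (λ i → bit (lookup X i) + bit (lookup Y i))
        ≡⟨ ∑-distrib-+ (λ i → indicator α (g i) + indicator β (g i)) (λ i → bit (lookup X i) + bit
            (lookup Y i)) ⟨
      sum (λ i → indicator α (g i) + indicator β (g i) + (bit (lookup X i) + bit (lookup Y i)))
        ≡⟨ sum-cong-≗ pointwise ⟩
      sum {M} (λ _ → 1)
        ≡⟨ sum-ones M ⟩
      M ∎
      where
      open ≡-Reasoning
      at-helper : ∀ a b → mix a b ≡ 𝐳 → bit (a ∧ b) + bit (not (a ∨ b)) ≡ 0
      at-helper true  false _ = refl
      at-helper false true  _ = refl
      at-helper true  true  ()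
      at-helper false false ()
      off-helper : ∀ a b → indicator α (greek false (mix a b)) + indicator β (greek false (mix a b)) +
                   (bit (a ∧ b) + bit (not (a ∨ b))) ≡ 1
      off-helper true  true  = refl
      off-helper true  false = refl
      off-helper false true  = refl
      off-helper false false = refl
      pointwise : ∀ i → indicator α (g i) + indicator β (g i) + (bit (lookup X i) + bit (lookup Y i)) ≡ 1
      pointwise i rewrite lookup-both T i | lookup-neither T i with i Fin.≟ e
      ... | no _     = off-helper (lookup T (el true i)) (lookup T (el false i))
      ... | yes refl = cong suc (at-helper (lookup T (el true e)) (lookup T (el false e)) at-e)

    count-α-even : Even (count (_≟ˢ α) d′)
    count-α-even = helper (parity (count (_≟ˢ α) d′)) (begin
      parity (count (_≟ˢ α) d′) ℙ.+ 1ℙ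
        ≡⟨ ℙ.+-identityʳ _ ⟨
      parity (count (_≟ˢ α) d′) ℙ.+ 1ℙ ℙ.+ 0ℙ
        ≡⟨ cong₂ ℙ._+_ (ℙ.+-homo-+ (count (_≟ˢ α) d′) 1) (trans (ℙ.+-homo-+ ∣ X ∣ ∣ X ∣)
            (ℙ.p+p≡0ℙ (parity ∣ X ∣))) ⟨
      parity (count (_≟ˢ α) d′ + 1) ℙ.+ parity (∣ X ∣ + ∣ X ∣)
        ≡⟨ ℙ.+-homo-+ (count (_≟ˢ α) d′ + 1) (∣ X ∣ + ∣ X ∣) ⟨
      parity (count (_≟ˢ α) d′ + 1 + (∣ X ∣ + ∣ X ∣))
        ≡⟨ cong parity count-all ⟩
      parity M
        ≡⟨ 1+n-odd ⟩
      1ℙ ∎)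
      where
      open ≡-Reasoning
      helper : ∀ p → p ℙ.+ 1ℙ ≡ 1ℙ → p ≡ 0ℙ
      helper 0ℙ _ = refl

    sgn≐β : sgn X Y ≐ ｛ β ｝
    sgn≐β = only-β , λ { refl → inj₂ refl , d′ , resolution , cong parity count-β }
      where
      only-β : ∀ {s} → sgn X Y s → β ≡ s
      only-β (inj₂ refl , _) = refl
      -- A priori `d″` is some other resolution with an odd number of `α`; uniqueness identifies it
      -- with `d′`, where the number is even.
      only-β (inj₁ refl , d″ , res , odd) = contradiction (trans (sym even) odd) λ ()
        where
        even : Even (count (_≟ˢ α) d″)
        even = trans (cong (parity ∘ count (_≟ˢ α))
          (resolution-unique {X = X} {Y} res resolution (e ⊕ 1 ⊕ 1) (λ z → non-𝐳
            (trans (kind≡letter T _) z)))) count-α-even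

    T∈⟨X∣Y⟩ : ⟨_∣_⟩ M X Y T
    T∈⟨X∣Y⟩ = ⊆⟨⟩ {[_∣_] M X Y} (∈-own-bracket T)

    ∈ℋ : ℋ M T
    ∈ℋ = inj₂ (X , Y , (card-both≡neither T size , disjoint⇒∩≡⊥ (both-neither-disjoint T) , ≢⟨⊥∣⊥⟩) ,
               (λ eq → ∉⟨C∣C⊞1⟩ (proj₁ eq T∈⟨X∣Y⟩)) , (λ eq → ∉⟨C⊞1∣C⟩ (proj₁ eq T∈⟨X∣Y⟩)) , sgn≐β , T∈⟨X∣Y⟩)
      where
      ≢⟨⊥∣⊥⟩ : ¬ (⟨_∣_⟩ M X Y ≐ ⟨_∣_⟩ M ⊥ ⊥)
      ≢⟨⊥∣⊥⟩ eq = non-𝐳 (⟨⊥∣⊥⟩⇒𝐳 T (proj₁ eq T∈⟨X∣Y⟩) (e ⊕ 1 ⊕ 1))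

      ∉⟨C⊞1∣C⟩ : ¬ ⟨_∣_⟩ M (C M ⊞ 1) (C M) T
      ∉⟨C⊞1∣C⟩ T∈ = let (k , alt) = ⟨∣⟩⇒alternating {C M ⊞ 1} {C M} {0ℙ} {T} alternating-C⊞1∣C T∈ in
        after (alternating-after {kind T} {k} alt e at-e)

      ∉⟨C∣C⊞1⟩ : ¬ ⟨_∣_⟩ M (C M) (C M ⊞ 1) T
      ∉⟨C∣C⊞1⟩ T∈ = let (k , alt) = ⟨∣⟩⇒alternating {C M} {C M ⊞ 1} {1ℙ} {T} alternating-C∣C⊞1 T∈ in
        before (alternating-before {kind T} {k} alt e′ at-e)


  -- Cardinality of the blocks

  -- Both systems in one definition: the parities `1ℙ` and `0ℙ` give `𝒮₁` and `𝒮₂`, and a swap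
  -- replaces the parity by its inverse.
  𝒮 : Parity → SetSystem (M + M)
  𝒮 p S = ℋ M S ⊎ (∃[ J ] parity ∣ J ∣ ≡ p × S ≡ F M J)

  kind-F : ∀ J i → kind (F M J) i ≡ 𝐳
  kind-F J i = trans (cong₂ mix (lookup-++ˡ J (∁ J) i) (trans (lookup-++ʳ J (∁ J) i) (lookup-map i not J)))
      (helper (lookup J i))
    where
    helper : ∀ a → mix a (not a) ≡ 𝐳
    helper true  = refl
    helper false = refl

  card-all-𝐳 : ∀ S → (∀ i → kind S i ≡ 𝐳) → ∣ S ∣ ≡ M
  card-all-𝐳 S all-𝐳 = trans (card-kind S) (trans (sum-cong-≗ (cong weight ∘ all-𝐳)) (sum-ones M))

  card-⟨∣⟩ : ∀ {X Y S} → ∣ X ∣ ≡ ∣ Y ∣ → Disjoint X Y → ⟨_∣_⟩ M X Y S → ∣ S ∣ ≡ M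
  card-⟨∣⟩ {X} {Y} {S} ∣X∣≡∣Y∣ dis S∈ =
    let (l , pull∈) = ⟨⟩⁻ {[_∣_] M X Y} S∈
        R = pull (ρ M ^ label {M} l) S
    in trans (sym (card-pull-ρ^ (label≤ l) S)) (ℕ.+-cancelʳ-≡ ∣ Y ∣ _ _
         (trans (kind⇒card {X} {Y} {R} dis (bracket⇒kind {X} {Y} pull∈)) (cong (M +_) ∣X∣≡∣Y∣)))

  card-𝒮 : ∀ p {S} → 𝒮 p S → ∣ S ∣ ≡ M
  card-𝒮 p {S} (inj₁ (inj₁ S∈)) = let (l , eq) = ⟨⟩⁻ {｛ A M ｝ U.∪ ｛ B M ｝} S∈ in
    trans (sym (card-pull-ρ^ (label≤ l) S)) (Sum.[ (λ A≡ → trans (cong ∣_∣ (sym A≡)) card-A) ,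
        (λ B≡ → trans (cong ∣_∣ (sym B≡)) card-B) ]′ eq)
  card-𝒮 p (inj₁ (inj₂ (X , Y , (∣X∣≡∣Y∣ , X∩Y≡⊥ , _) , _ , _ , _ , S∈))) = card-⟨∣⟩ ∣X∣≡∣Y∣
      (∩≡⊥⇒disjoint X∩Y≡⊥) S∈
  card-𝒮 p {S} (inj₂ (J , _ , S≡F)) = card-all-𝐳 S (λ i → trans (cong (λ T → kind T i) S≡F) (kind-F J i))

  sperner : ∀ p → Sperner (𝒮 p)
  sperner p S∈ T∈ S⊆T = ⊆∧∣∣≡⇒≡ S⊆T (trans (card-𝒮 p S∈) (sym (card-𝒮 p T∈)))

  first : Subset (M + M) → Subset M
  first T = tabulate (lookup T ∘ el true)

  all-𝐳⇒≡F : ∀ T → (∀ i → kind T i ≡ 𝐳) → T ≡ F M (first T)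
  all-𝐳⇒≡F T all-𝐳 = subset-ext λ x → at x (over? x)
    where
    helper : ∀ a b → mix a b ≡ 𝐳 → b ≡ not a
    helper true  false _ = refl
    helper false true  _ = refl
    at : ∀ x → Over x → lookup T x ≡ lookup (F M (first T)) x
    at _ (over true i)  = sym (trans (lookup-++ˡ (first T) _ i) (lookup∘tabulate (lookup T ∘ el true) i))
    at _ (over false i) = trans (helper (lookup T (el true i)) (lookup T (el false i)) (all-𝐳 i))
      (sym (trans (lookup-++ʳ (first T) _ i) (trans (lookup-map i not (first T))
        (cong not (lookup∘tabulate (lookup T ∘ el true) i)))))

  all-𝐳-∈𝒮 : ∀ {p} T → (∀ i → kind T i ≡ 𝐳) → parity ∣ first T ∣ ≡ p → 𝒮 p T
  all-𝐳-∈𝒮 T all-𝐳 eq = inj₂ (first T , eq , all-𝐳⇒≡F T all-𝐳)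

  parity-first : ∀ T T′ k → (lookup T′ (el true k) ≡ not (lookup T (el true k))) →
                 (∀ i → i ≢ k → lookup T′ (el true i) ≡ lookup T (el true i)) →
                 parity ∣ first T′ ∣ ≡ parity ∣ first T ∣ ⁻¹
  parity-first T T′ k at off = parity-flip (first T) (first T′) k
    (trans (lookup-first T′ k) (trans at (cong not (sym (lookup-first T k)))))
    (λ i i≢k → trans (lookup-first T′ i) (trans (off i i≢k) (sym (lookup-first T i))))
    where
    lookup-first : ∀ T i → lookup (first T) i ≡ lookup T (el true i)
    lookup-first T = lookup∘tabulate (lookup T ∘ el true)

  -- Swapping k and k′

  coordinates : Fin (M + M) → Bool × Fin M
  coordinates x = Sum.[ (true ,_) , (false ,_) ] (splitAt M x)

  coordinates-el : ∀ s i → coordinates (el s i) ≡ (s , i)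
  coordinates-el true  i = cong Sum.[ (true ,_) , (false ,_) ] (Fin.splitAt-↑ˡ M i M)
  coordinates-el false i = cong Sum.[ (true ,_) , (false ,_) ] (Fin.splitAt-↑ʳ M M i)

  flip-at : Fin M → Bool × Fin M → Fin (M + M)
  flip-at k (s , i) = el (if does (i Fin.≟ k) then not s else s) i

  swap : Fin M → Fin (M + M) → Fin (M + M)
  swap k x = flip-at k (coordinates x)

  swap-el-≡ : ∀ k s → swap k (el s k) ≡ el (not s) k
  swap-el-≡ k s = trans (cong (flip-at k) (coordinates-el s k))
    (cong (λ b → el (if b then not s else s) k) (dec-true (k Fin.≟ k) refl))

  swap-el-≢ : ∀ {k i} s → i ≢ k → swap k (el s i) ≡ el s i
  swap-el-≢ {k} {i} s i≢k = trans (cong (flip-at k) (coordinates-el s i))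
    (cong (λ b → el (if b then not s else s) i) (dec-false (i Fin.≟ k) i≢k))

  swap-involutive : ∀ k x → swap k (swap k x) ≡ x
  swap-involutive k x = at x (over? x)
    where
    at : ∀ x → Over x → swap k (swap k x) ≡ x
    at _ (over s i) with i Fin.≟ k
    ... | no  i≢k  = trans (cong (swap k) (swap-el-≢ s i≢k)) (swap-el-≢ s i≢k)
    ... | yes refl = trans (cong (swap k) (swap-el-≡ k s)) (trans (swap-el-≡ k (not s))
          (cong (λ b → el b k) (not-involutive s)))

  lookup-swap-≡ : ∀ k S s → lookup (pull (swap k) S) (el s k) ≡ lookup S (el (not s) k)
  lookup-swap-≡ k S s = trans (lookup-pull (swap k) S (el s k)) (cong (lookup S) (swap-el-≡ k s))

  lookup-swap-≢ : ∀ {k i} S s → i ≢ k → lookup (pull (swap k) S) (el s i) ≡ lookup S (el s i)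
  lookup-swap-≢ {k} {i} S s i≢k = trans (lookup-pull (swap k) S (el s i)) (cong (lookup S) (swap-el-≢ s i≢k))

  kind-swap : ∀ k S i → kind (pull (swap k) S) i ≡ kind S i
  kind-swap k S i = at (i Fin.≟ k)
    where
    mix-comm : ∀ a b → mix a b ≡ mix b a
    mix-comm true  true  = refl
    mix-comm true  false = refl
    mix-comm false true  = refl
    mix-comm false false = refl
    at : Dec (i ≡ k) → kind (pull (swap k) S) i ≡ kind S i
    at (no  i≢k)  = cong₂ mix (lookup-swap-≢ S true i≢k) (lookup-swap-≢ S false i≢k)
    at (yes refl) = trans (cong₂ mix (lookup-swap-≡ i S true) (lookup-swap-≡ i S false))
        (mix-comm (lookup S (el false i)) (lookup S (el true i)))

  card-swap : ∀ k S → ∣ pull (swap k) S ∣ ≡ ∣ S ∣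
  card-swap k S = trans (card-kind (pull (swap k) S)) (trans
      (sum-cong-≗ (λ i → cong weight (kind-swap k S i))) (sym (card-kind S)))

  -- A letter other than `𝐳` means that both copies of `k` are in `S` or neither is, and exchanging
  -- them changes nothing.
  swap-stable : ∀ k S → kind S k ≢ 𝐳 → pull (swap k) S ≡ S
  swap-stable k S k≢𝐳 = subset-ext λ x → at x (over? x)
    where
    equal-copies : ∀ s → lookup S (el (not s) k) ≡ lookup S (el s k)
    equal-copies s with lookup S (el true k) in eq | lookup S (el false k) in eq′
    equal-copies true  | true  | true  = trans eq′ (sym eq)
    equal-copies false | true  | true  = trans eq (sym eq′)
    equal-copies true  | false | false = trans eq′ (sym eq)
    equal-copies false | false | false = trans eq (sym eq′)
    equal-copies _     | true  | false = contradiction refl k≢𝐳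
    equal-copies _     | false | true  = contradiction refl k≢𝐳
    at : ∀ x → Over x → lookup (pull (swap k) S) x ≡ lookup S x
    at _ (over s i) = by (i Fin.≟ k)
      where
      by : Dec (i ≡ k) → lookup (pull (swap k) S) (el s i) ≡ lookup S (el s i)
      by (no  i≢k)  = lookup-swap-≢ S s i≢k
      by (yes refl) = trans (lookup-swap-≡ i S s) (equal-copies s)

  -- Membership depends only on the word of a set, which the swap leaves alone.
  swap-⟨∣⟩ : ∀ k {X Y S} → Disjoint X Y → ⟨_∣_⟩ M X Y S → ⟨_∣_⟩ M X Y (pull (swap k) S)
  swap-⟨∣⟩ k {X} {Y} {S} dis S∈ =
    let (l , pull∈) = ⟨⟩⁻ {[_∣_] M X Y} S∈
        q = label {M} l
    in ⟨⟩⁺ {[_∣_] M X Y} l (kind⇒bracket {X} {Y} {pull (ρ M ^ q) (pull (swap k) S)} dis λ i →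
         trans (kind-pull-ρ^ q (pull (swap k) S) i) (trans (kind-swap k S (i ⊕ q))
           (trans (sym (kind-pull-ρ^ q S i)) (bracket⇒kind {X} {Y} pull∈ i))))

  -- Swapping inserts `k` into `J` or deletes it, so the size of `J` changes by one.
  swap-F : ∀ k {p S} → (∃[ J ] parity ∣ J ∣ ≡ p × S ≡ F M J) → 𝒮 (p ⁻¹) (pull (swap k) S)
  swap-F k {S = S} (J , refl , S≡F) = all-𝐳-∈𝒮 (pull (swap k) S) (λ i → trans (kind-swap k S i) (all-𝐳 i))
    (trans (parity-first S (pull (swap k) S) k (trans (lookup-swap-≡ k S true)
      (opposite (lookup S (el true k)) (lookup S (el false k)) (all-𝐳 k)))
      (λ i → lookup-swap-≢ S true)) (cong (λ J → parity ∣ J ∣ ⁻¹) first≡J))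
    where
    all-𝐳 : ∀ i → kind S i ≡ 𝐳
    all-𝐳 i = trans (cong (λ T → kind T i) S≡F) (kind-F J i)
    opposite : ∀ a b → mix a b ≡ 𝐳 → b ≡ not a
    opposite true  false _ = refl
    opposite false true  _ = refl
    first≡J : first S ≡ J
    first≡J = subset-ext λ i → trans (lookup∘tabulate (lookup S ∘ el true) i)
      (trans (cong (λ T → lookup T (el true i)) S≡F) (lookup-++ˡ J (∁ J) i))


  -- Redundancy of the alternating blocks

  has-element : ∀ S k → kind S k ≡ 𝐳 → ∃[ s ] lookup S (el s k) ≡ true
  has-element S k = helper refl refl
    where
    helper : ∀ {a b} → lookup S (el true k) ≡ a → lookup S (el false k) ≡ b → mix a b ≡ 𝐳 →
             ∃[ s ] lookup S (el s k) ≡ true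
    helper {true}  {false} eq _  _ = true , eq
    helper {false} {true}  _  eq _ = false , eq

  kind-𝐱 : ∀ S i → kind S i ≡ 𝐱 → ∀ s → lookup S (el s i) ≡ true
  kind-𝐱 S i eq s = helper (lookup S (el true i)) (lookup S (el false i)) refl refl eq s
    where
    helper : ∀ a b → lookup S (el true i) ≡ a → lookup S (el false i) ≡ b → mix a b ≡ 𝐱 →
             ∀ s → lookup S (el s i) ≡ true
    helper true true eq _  _ true  = eq
    helper true true _  eq _ false = eq
    helper true  false _ _ ()
    helper false true  _ _ ()
    helper false false _ _ ()

  kind-𝐲 : ∀ S i → kind S i ≡ 𝐲 → ∀ s → lookup S (el s i) ≡ false
  kind-𝐲 S i eq s = helper (lookup S (el true i)) (lookup S (el false i)) refl refl eq s
    where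
    helper : ∀ a b → lookup S (el true i) ≡ a → lookup S (el false i) ≡ b → mix a b ≡ 𝐲 →
             ∀ s → lookup S (el s i) ≡ false
    helper false false eq _  _ true  = eq
    helper false false _  eq _ false = eq
    helper true  true  _ _ ()
    helper true  false _ _ ()
    helper false true  _ _ ()

  el-≢ : ∀ {s s′ i i′} → i ≢ i′ → el s i ≢ el s′ i′
  el-≢ {s} {s′} i≢i′ eq = i≢i′ (proj₂ (el-injective {s} {s′} eq))

  el-≢-copy : ∀ s i → el (not s) i ≢ el s i
  el-≢-copy s i eq = not-≢ s (proj₁ (el-injective {not s} {s} eq))
    where
    not-≢ : ∀ s → not s ≢ s
    not-≢ true  ()
    not-≢ false ()

  kind-via : ∀ S i s → kind S i ≡ mix (lookup S (el s i)) (lookup S (el (not s) i))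
  kind-via S i true  = refl
  kind-via S i false = helper (lookup S (el true i)) (lookup S (el false i))
    where
    helper : ∀ a b → mix a b ≡ mix b a
    helper true  true  = refl
    helper true  false = refl
    helper false true  = refl
    helper false false = refl

  -- One element moves from `p` to the empty index `r`. In the word, `𝐱` at `p` becomes `𝐳`, or `𝐳`
  -- at `p` becomes `𝐲`; the `𝐲` at `r` becomes `𝐳`.
  module Exchange (S : Subset (M + M)) (s s′ : Bool) (p r : Fin M) (p≢r : p ≢ r)
    (κ∈ : lookup S (el s p) ≡ true) (r𝐲 : kind S r ≡ 𝐲) where

    T : Subset (M + M)
    T = exchange S (el s p) (el s′ r)

    card-T : ∣ T ∣ ≡ ∣ S ∣
    card-T = card-exchange {S = S} κ∈ (kind-𝐲 S r r𝐲 s′)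

    kind-other : ∀ {i} → i ≢ p → i ≢ r → kind T i ≡ kind S i
    kind-other {i} i≢p i≢r = cong₂ mix (same true) (same false)
      where
      same : ∀ t → lookup T (el t i) ≡ lookup S (el t i)
      same t = lookup-exchange-other {S = S} (el-≢ {t} {s} i≢p) (el-≢ {t} {s′} i≢r)

    kind-p : kind T p ≡ mix false (lookup S (el (not s) p))
    kind-p = trans (kind-via T p s) (cong₂ mix (lookup-exchange-out {S = S} {el s p} {el s′ r})
      (lookup-exchange-other {S = S} (el-≢-copy s p) (el-≢ {not s} {s′} p≢r)))

    kind-p-𝐱 : kind S p ≡ 𝐱 → kind T p ≡ 𝐳
    kind-p-𝐱 x = trans kind-p (cong (mix false) (kind-𝐱 S p x (not s)))

    kind-p-𝐳 : kind S p ≡ 𝐳 → kind T p ≡ 𝐲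
    kind-p-𝐳 z = trans kind-p (cong (mix false) (helper (lookup S (el (not s) p))
      (trans (cong (λ b → mix b (lookup S (el (not s) p))) (sym κ∈)) (trans (sym (kind-via S p s)) z))))
      where
      helper : ∀ b → mix true b ≡ 𝐳 → b ≡ false
      helper false _ = refl

    kind-r : kind T r ≡ 𝐳
    kind-r = trans (kind-via T r s′) (cong₂ mix (lookup-exchange-in {S = S} {el s p} {el s′ r}
        (el-≢ {s′} {s} (p≢r ∘ sym)))
      (trans (lookup-exchange-other {S = S} (el-≢ {not s′} {s} (p≢r ∘ sym)) (el-≢-copy s′ r))
        (kind-𝐲 S r r𝐲 (not s′))))

  module Redundancy (I : Subset (M + M)) (S : Subset (M + M)) (size : ∣ S ∣ ≡ M)
    (k : Fin M) (ε : Parity) (alt : Alternating (kind S) k ε) where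

    off-k : ∀ t → t < 2 + n → kind S (k ⊕ suc t) ≡ col (ε ℙ.+ parity t)
    off-k = proj₂ alt

    k⊕-distinct : ∀ {p q} → p < M → q < M → p ≢ q → k ⊕ p ≢ k ⊕ q
    k⊕-distinct = ⊕-distinct k

    k⊕≢k : ∀ {t} → t < 2 + n → k ⊕ suc t ≢ k
    k⊕≢k t< eq = k⊕-distinct (s≤s t<) (s≤s z≤n) (λ ()) (trans eq (sym (⊕-zero k)))

    𝐲-at : ∀ {t} → t < 2 + n → ε ℙ.+ parity t ≡ 0ℙ → kind S (k ⊕ suc t) ≡ 𝐲
    𝐲-at {t} t< eq = trans (off-k t t<) (cong col eq)

    𝐱-at : ∀ {t} → t < 2 + n → ε ℙ.+ parity t ≡ 1ℙ → kind S (k ⊕ suc t) ≡ 𝐱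
    𝐱-at {t} t< eq = trans (off-k t t<) (cong col eq)

    -- The element over `k` moves to the empty index `r`. This makes `k` empty and leaves the only
    -- `𝐳` at `r`. As `2 + u` lies between 2 and m - 2, both neighbours of `r` differ from `k`, so
    -- they still carry `𝐱`, and `Membership` applies with `e` at `r`.
    apart : ∀ {u} s′ → u < n → ε ℙ.+ parity (suc u) ≡ 0ℙ → ∀ {v} → v ∈ I → v ∈ S → el s′ (k ⊕ (2 + u)) ∈ I →
            ∃[ T ] ℋ M T × T ≼[ I ] S
    apart {u} s′ u<n odd-u v∈I v∈S w∈I = T , ∈ℋ , exchange-≼ {S = S} v∈I w∈I v∈S
      where
      r : Fin M
      r = k ⊕ (2 + u)

      s : Bool
      s = proj₁ (has-element S k (proj₁ alt))

      1+u< : suc u < 2 + n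
      1+u< = s≤s (ℕ.m<n⇒m<1+n u<n)

      r𝐲 : kind S r ≡ 𝐲
      r𝐲 = 𝐲-at 1+u< odd-u

      even-u : ε ℙ.+ parity u ≡ 1ℙ
      even-u = helper ε (parity u) (trans (cong (ε ℙ.+_) (sym (parity-suc u))) odd-u)
        where
        helper : ∀ a b → a ℙ.+ b ⁻¹ ≡ 0ℙ → a ℙ.+ b ≡ 1ℙ
        helper 0ℙ 1ℙ _ = refl
        helper 1ℙ 0ℙ _ = refl

      open Exchange S s s′ k r (k⊕≢k 1+u< ∘ sym) (proj₂ (has-element S k (proj₁ alt))) r𝐲

      e′ : Fin M
      e′ = k ⊕ suc u

      e≡r : e′ ⊕ 1 ≡ r
      e≡r = ⊕-suc k (suc u)

      e⊕1≡ : e′ ⊕ 1 ⊕ 1 ≡ k ⊕ (3 + u)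
      e⊕1≡ = trans (cong (_⊕ 1) e≡r) (⊕-suc k (2 + u))

      2+u< : 2 + u < 2 + n
      2+u< = s≤s (s≤s u<n)

      u< : u < 2 + n
      u< = ℕ.m<n⇒m<1+n (ℕ.m<n⇒m<1+n u<n)

      kind-𝐱-T : ∀ {t} → t < 2 + n → t ≢ suc u → ε ℙ.+ parity t ≡ 1ℙ → kind T (k ⊕ suc t) ≢ 𝐲
      kind-𝐱-T {t} t< t≢ par eq = 𝐱≢𝐲 (trans (sym (𝐱-at t< par)) (trans (sym (kind-other (k⊕≢k t<)
        (k⊕-distinct (s≤s t<) (s≤s 1+u<) (t≢ ∘ ℕ.suc-injective)))) eq))
        where
        𝐱≢𝐲 : 𝐱 ≢ 𝐲
        𝐱≢𝐲 ()

      𝐳⇒r : ∀ i → kind T i ≡ 𝐳 → i ≡ r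
      𝐳⇒r i z = by (i Fin.≟ k) (i Fin.≟ r)
        where
        by : Dec (i ≡ k) → Dec (i ≡ r) → i ≡ r
        by _          (yes i≡r) = i≡r
        by (yes refl) (no _)    = contradiction (trans (sym z) (kind-p-𝐳 (proj₁ alt))) λ ()
        by (no i≢k)   (no i≢r)  = contradiction (alternating-𝐳 {kind S} {k} ε alt i
            (trans (sym (kind-other i≢k i≢r)) z)) i≢k

      open Membership T e′ (trans (cong (kind T) e≡r) kind-r)
        (kind-𝐱-T u< (ℕ.<⇒≢ (ℕ.n<1+n u)) even-u)
        (λ eq → kind-𝐱-T 2+u< (ℕ.>⇒≢ (ℕ.n<1+n (suc u))) even-u (trans (cong (kind T) (sym e⊕1≡)) eq))
        (λ i z i≢e′ → contradiction (⊕-injective (s≤s z≤n) (trans (𝐳⇒r (i ⊕ 1) z) (sym e≡r))) i≢e′)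
        (trans card-T size)
        using (∈ℋ)

    -- The exchange leaves 𝐳 exactly on the three consecutive positions p, a and b.
    adjacent : ∀ s′ p r a b → kind S p ≡ 𝐱 → kind S r ≡ 𝐲 → p ⊕ 1 ≡ a → a ⊕ 1 ≡ b →
               (a ≡ k × b ≡ r) ⊎ (a ≡ r × b ≡ k) →
               (n ≢ 0 → ∀ i → i ⊕ 1 ≡ p → kind S i ≡ 𝐲 × i ≢ r) →
               ∀ {v} → v ∈ I → v ∈ S → el s′ r ∈ I →
               ∀ q → ∃[ T ] 𝒮 q T × T ≼[ I ] S
    adjacent s′ p r a b p𝐱 r𝐲 p⊕1≡a a⊕1≡b ab before-p {v} v∈I v∈S w∈I q = decide (n ℕ.≟ 0)
      where
      p≢r : p ≢ r
      p≢r refl with () ← trans (sym p𝐱) r𝐲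

      -- Both copies over `p` are present and either may be removed. The choice matters when m = 3:
      -- there `T s` is a block F_J, and `s` decides the parity of J.
      module E (s : Bool) = Exchange S s s′ p r p≢r (kind-𝐱 S p p𝐱 s) r𝐲

      T : Bool → Subset (M + M)
      T = E.T

      T≼S : ∀ s → T s ≼[ I ] S
      T≼S s = exchange-≼ {S = S} v∈I w∈I v∈S

      k≢p : k ≢ p
      k≢p refl with () ← trans (sym p𝐱) (proj₁ alt)

      k≢r : k ≢ r
      k≢r refl with () ← trans (sym r𝐲) (proj₁ alt)

      kind-k : ∀ s → kind (T s) k ≡ 𝐳
      kind-k s = trans (E.kind-other s k≢p k≢r) (proj₁ alt)

      kind-a : ∀ s → kind (T s) a ≡ 𝐳
      kind-a s = Sum.[ (λ (a≡k , _) → trans (cong (kind (T s)) a≡k) (kind-k s)) ,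
                       (λ (a≡r , _) → trans (cong (kind (T s)) a≡r) (E.kind-r s)) ]′ ab

      kind-b : ∀ s → kind (T s) b ≡ 𝐳
      kind-b s = Sum.[ (λ (_ , b≡r) → trans (cong (kind (T s)) b≡r) (E.kind-r s)) ,
                       (λ (_ , b≡k) → trans (cong (kind (T s)) b≡k) (kind-k s)) ]′ ab

      𝐳⇒ : ∀ s i → kind (T s) i ≡ 𝐳 → i ≡ p ⊎ i ≡ a ⊎ i ≡ b
      𝐳⇒ s i z = by (i Fin.≟ p) (i Fin.≟ r)
        where
        by : Dec (i ≡ p) → Dec (i ≡ r) → i ≡ p ⊎ i ≡ a ⊎ i ≡ b
        by (yes i≡p) _ = inj₁ i≡p
        by (no _) (yes i≡r) = inj₂ (Sum.[ (λ (_ , b≡r) → inj₂ (trans i≡r (sym b≡r))) ,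
            (λ (a≡r , _) → inj₁ (trans i≡r (sym a≡r))) ]′ ab)
        by (no i≢p) (no i≢r) = inj₂ (Sum.[ (λ (a≡k , _) → inj₁ (trans i≡k (sym a≡k))) ,
            (λ (_ , b≡k) → inj₂ (trans i≡k (sym b≡k))) ]′ ab)
          where
          i≡k : i ≡ k
          i≡k = alternating-𝐳 {kind S} {k} ε alt i (trans (sym (E.kind-other s i≢p i≢r)) z)

      in-ℋ : n ≢ 0 → ℋ M (T true)
      -- The special position `e` is the middle one, `a`: then `p` follows a `𝐲` and `b` follows
      -- `e`, as `others` demands, and the run reads `α`, `β`, `α`.
      in-ℋ n≢0 = Membership.∈ℋ (T true) p (trans (cong (kind (T true)) p⊕1≡a) (kind-a true))
        (λ y → contradiction (trans (sym y) (E.kind-p-𝐱 true p𝐱)) λ ())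
        (λ y → contradiction (trans (sym y) (trans (cong (kind (T true)) (trans (cong (_⊕ 1) p⊕1≡a) a⊕1≡b))
          (kind-b true))) λ ())
        others (trans (E.card-T true) size)
        where
        others : ∀ i → kind (T true) (i ⊕ 1) ≡ 𝐳 → i ≢ p → kind (T true) i ≡ 𝐲 ⊎ i ≡ p ⊕ 1
        others i z i≢p = by (𝐳⇒ true (i ⊕ 1) z)
          where
          by : i ⊕ 1 ≡ p ⊎ i ⊕ 1 ≡ a ⊎ i ⊕ 1 ≡ b → kind (T true) i ≡ 𝐲 ⊎ i ≡ p ⊕ 1
          by (inj₁ eq)        = let (y , i≢r) = before-p n≢0 i eq in inj₁
              (trans (E.kind-other true i≢p i≢r) y)
          by (inj₂ (inj₁ eq)) = contradiction (⊕-injective (s≤s z≤n) (trans eq (sym p⊕1≡a))) i≢p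
          by (inj₂ (inj₂ eq)) = inj₂ (trans (⊕-injective (s≤s z≤n) (trans eq (sym a⊕1≡b))) (sym p⊕1≡a))

      parity-T : parity ∣ first (T false) ∣ ≡ parity ∣ first (T true) ∣ ⁻¹
      parity-T = parity-first (T true) (T false) p
        (trans (lookup-exchange-other {S = S} (el-≢-copy false p) (el-≢ {true} {s′} p≢r))
          (trans (kind-𝐱 S p p𝐱 true) (cong not (sym (lookup-exchange-out {S = S} {el true p} {el s′ r})))))
        (λ i i≢p → by i i≢p (el true i Fin.≟ el s′ r))
        where
        by : ∀ i → i ≢ p → Dec (el true i ≡ el s′ r) →
             lookup (T false) (el true i) ≡ lookup (T true) (el true i)
        by i i≢p (no ≢w) = trans (lookup-exchange-other {S = S} (el-≢ {true} {false} i≢p) ≢w)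
          (sym (lookup-exchange-other {S = S} (el-≢ {true} {true} i≢p) ≢w))
        by i i≢p (yes ≡w) = trans (cong (lookup (T false)) ≡w) (trans
            (lookup-exchange-in {S = S} {el false p} {el s′ r} (el-≢ {s′} {false} (p≢r ∘ sym)))
          (sym (trans (cong (lookup (T true)) ≡w) (lookup-exchange-in {S = S} {el true p} {el s′ r}
            (el-≢ {s′} {true} (p≢r ∘ sym))))))

      all-𝐳 : n ≡ 0 → ∀ s i → kind (T s) i ≡ 𝐳
      all-𝐳 n≡0 s i = let (t , t< , i≡) = ⊕-reach p i in
        trans (cong (kind (T s)) i≡) (by t (subst (λ n → t < 3 + n) n≡0 t<))
        where
        by : ∀ t → t < 3 → kind (T s) (p ⊕ t) ≡ 𝐳
        by 0 _ = trans (cong (kind (T s)) (⊕-zero p)) (E.kind-p-𝐱 s p𝐱)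
        by 1 _ = trans (cong (kind (T s)) p⊕1≡a) (kind-a s)
        by 2 _ = trans (cong (kind (T s)) (trans (sym (⊕-suc p 1)) (trans (cong (_⊕ 1) p⊕1≡a) a⊕1≡b)))
            (kind-b s)
        by (suc (suc (suc _))) (s≤s (s≤s (s≤s ())))

      decide : Dec (n ≡ 0) → ∃[ T ] 𝒮 q T × T ≼[ I ] S
      decide (no n≢0)  = T true , inj₁ (in-ℋ n≢0) , T≼S true
      decide (yes n≡0) with parity ∣ first (T true) ∣ ℙ.≟ q
      ... | yes eq = T true , all-𝐳-∈𝒮 (T true) (all-𝐳 n≡0 true) eq , T≼S true
      ... | no  ne = T false , all-𝐳-∈𝒮 (T false) (all-𝐳 n≡0 false) (trans parity-T
            (other _ q ne)) , T≼S false
        where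
        other : ∀ a b → a ≢ b → a ⁻¹ ≡ b
        other 0ℙ 0ℙ ne = contradiction refl ne
        other 0ℙ 1ℙ _  = refl
        other 1ℙ 0ℙ _  = refl
        other 1ℙ 1ℙ ne = contradiction refl ne


  -- Choice of the index `k`

  Redundant : Subset (M + M) → Fin M → Set
  Redundant I k = ∀ q {S} ε → ∣ S ∣ ≡ M → Alternating (kind S) k ε → ∃[ T ] 𝒮 q T × T ≼[ I ] S

  ⊕-full-turn : ∀ (i : Fin M) t → i ⊕ (t + M) ≡ i ⊕ t
  ⊕-full-turn i t = trans (sym (⊕-assoc i t M)) (⊕-period (i ⊕ t))

  -- The arc from `i` to `i ⊕ d` avoids `k` and has odd length, so the two letters are opposite. The
  -- index with `𝐲` receives the new element; the other, with `𝐱`, provides the element of `I` that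
  -- is already present.
  redundant-apart : ∀ {I} s s′ i {d} → d < n → Odd d → el s i ∈ I → el s′ (i ⊕ d) ∈ I →
                    Redundant I (i ⊕ (2 + d))
  redundant-apart {I} s s′ i {d} d<n d-odd i∈I j∈I q {S} ε size alt = by (ε ℙ.+ parity (suc c)) refl
    where
    open Redundancy I S size (i ⊕ (2 + d)) ε alt
    k : Fin M
    k = i ⊕ (2 + d)
    c : ℕ
    -- Chosen so that (2 + d) + (2 + c) = m: from `k` it takes `2 + c` steps to `i` and `d` more to
    -- the second index.
    c = n ∸ suc d
    1+d+c≡n : suc d + c ≡ n
    1+d+c≡n = ℕ.m+[n∸m]≡n d<n
    at-i : k ⊕ (2 + c) ≡ i
    at-i = begin
      i ⊕ (2 + d) ⊕ (2 + c)  ≡⟨ ⊕-assoc i (2 + d) (2 + c) ⟩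
      i ⊕ (2 + d + (2 + c))  ≡⟨ cong (λ t → i ⊕ (2 + t)) (trans (ℕ.+-suc d (suc c))
          (cong suc (ℕ.+-suc d c))) ⟩
      i ⊕ (3 + (suc d + c))  ≡⟨ cong (λ t → i ⊕ (3 + t)) 1+d+c≡n ⟩
      i ⊕ M                  ≡⟨ ⊕-period i ⟩
      i                      ∎
      where open ≡-Reasoning
    at-j : k ⊕ (2 + (d + c)) ≡ i ⊕ d
    at-j = begin
      k ⊕ (2 + (d + c))      ≡⟨ cong (k ⊕_) (cong (2 +_) (ℕ.+-comm c d)) ⟨
      k ⊕ (2 + c + d)        ≡⟨ ⊕-assoc k (2 + c) d ⟨
      k ⊕ (2 + c) ⊕ d        ≡⟨ cong (_⊕ d) at-i ⟩
      i ⊕ d                  ∎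
      where
      open ≡-Reasoning
    c<n : c < n
    c<n = subst (c <_) 1+d+c≡n (s≤s (ℕ.m≤n+m c d))
    d+c<n : d + c < n
    d+c<n = subst (d + c <_) 1+d+c≡n ℕ.≤-refl
    parity-j : ε ℙ.+ parity (suc (d + c)) ≡ (ε ℙ.+ parity (suc c)) ⁻¹
    parity-j = trans (cong (λ t → ε ℙ.+ t) (begin
      parity (suc (d + c))        ≡⟨ cong parity (ℕ.+-suc d c) ⟨
      parity (d + suc c)          ≡⟨ ℙ.+-homo-+ d (suc c) ⟩
      parity d ℙ.+ parity (suc c) ≡⟨ cong (ℙ._+ parity (suc c)) d-odd ⟩
      parity (suc c) ⁻¹           ∎)) (helper ε (parity (suc c)))
      where
      open ≡-Reasoning
      helper : ∀ a b → a ℙ.+ b ⁻¹ ≡ (a ℙ.+ b) ⁻¹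
      helper 0ℙ b = refl
      helper 1ℙ b = refl
    below : ∀ {t} → t < n → suc t < 2 + n
    below t<n = s≤s (ℕ.m<n⇒m<1+n t<n)
    in-ℋ : (∃[ T ] ℋ M T × T ≼[ I ] S) → ∃[ T ] 𝒮 q T × T ≼[ I ] S
    in-ℋ (T , T∈ , T≼S) = T , inj₁ T∈ , T≼S
    by : ∀ p → ε ℙ.+ parity (suc c) ≡ p → ∃[ T ] 𝒮 q T × T ≼[ I ] S
    by 0ℙ eq = in-ℋ (apart s c<n eq (subst (λ j → el s′ j ∈ I) (sym at-j) j∈I)
      (∈-pred (kind-𝐱 S (k ⊕ (2 + (d + c))) (𝐱-at (below d+c<n) (trans parity-j (cong _⁻¹ eq))) s′))
      (subst (λ j → el s j ∈ I) (sym at-i) i∈I))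
    by 1ℙ eq = in-ℋ (apart s′ d+c<n (trans parity-j (cong _⁻¹ eq)) (subst (λ j → el s j ∈ I) (sym at-i) i∈I)
      (∈-pred (kind-𝐱 S (k ⊕ (2 + c)) (𝐱-at (below c<n) eq) s))
      (subst (λ j → el s′ j ∈ I) (sym at-j) j∈I))

  -- For `0ℙ` an element moves from k - 1 to the empty index k + 1. For `1ℙ` the empty neighbour is
  -- k - 1, and the element comes from k - 2, not from k + 1: the run k - 1, k, k + 1 would follow
  -- an `𝐱` and read `β`, `α`, `β`, with signature `α`, whereas for m > 3 the run k - 2, k - 1, k
  -- follows a `𝐲`.
  redundant-adjacent : ∀ {I} s s′ k → el s (k ⊕ 1) ∈ I → el s′ (k ⊕ (2 + n)) ∈ I → Redundant I k
  redundant-adjacent {I} s s′ k i∈I j∈I q {S} 0ℙ size alt =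
    adjacent s (k ⊕ (2 + n)) (k ⊕ 1) k (k ⊕ 1) (𝐱-at ℕ.≤-refl 1+n-odd) (𝐲-at (s≤s z≤n) refl)
      (trans (⊕-suc k (2 + n)) (⊕-period k)) refl (inj₁ (refl , refl)) before
      j∈I (∈-pred (kind-𝐱 S (k ⊕ (2 + n)) (𝐱-at ℕ.≤-refl 1+n-odd) s′)) i∈I q
    where
    open Redundancy I S size k 0ℙ alt
    before : n ≢ 0 → ∀ i → i ⊕ 1 ≡ k ⊕ (2 + n) → kind S i ≡ 𝐲 × i ≢ k ⊕ 1
    before n≢0 i eq = subst (λ i → kind S i ≡ 𝐲 × i ≢ k ⊕ 1)
      (sym (⊕-injective (s≤s z≤n) (trans eq (sym (⊕-suc k (1 + n))))))
      (𝐲-at (ℕ.m<n⇒m<1+n ℕ.≤-refl) n-even ,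
       k⊕-distinct (ℕ.m<n⇒m<1+n ℕ.≤-refl) (s≤s (s≤s z≤n)) (n≢0 ∘ ℕ.suc-injective))
  redundant-adjacent {I} s s′ k i∈I j∈I q {S} 1ℙ size alt =
    adjacent s′ (k ⊕ (1 + n)) (k ⊕ (2 + n)) (k ⊕ (2 + n)) k (𝐱-at (ℕ.m<n⇒m<1+n ℕ.≤-refl)
        (cong (1ℙ ℙ.+_) n-even))
      (𝐲-at ℕ.≤-refl (cong (1ℙ ℙ.+_) 1+n-odd)) (⊕-suc k (1 + n)) (trans (⊕-suc k (2 + n)) (⊕-period k))
      (inj₂ (refl , refl)) before i∈I (∈-pred (kind-𝐱 S (k ⊕ 1) (𝐱-at (s≤s z≤n) refl) s)) j∈I q
    where
    open Redundancy I S size k 1ℙ alt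
    𝐲-at-n : ∀ t → t ≡ n → n ≢ 0 → kind S (k ⊕ t) ≡ 𝐲
    𝐲-at-n zero    0≡n n≢0 = contradiction (sym 0≡n) n≢0
    𝐲-at-n (suc t) t≡n _   = 𝐲-at (ℕ.≤-trans (ℕ.≤-reflexive t≡n) (ℕ.m≤n+m n 2))
      (trans (sym (parity-suc t)) (trans (cong parity t≡n) n-even))
    before : n ≢ 0 → ∀ i → i ⊕ 1 ≡ k ⊕ (1 + n) → kind S i ≡ 𝐲 × i ≢ k ⊕ (2 + n)
    before n≢0 i eq = subst (λ i → kind S i ≡ 𝐲 × i ≢ k ⊕ (2 + n))
      (sym (⊕-injective (s≤s z≤n) (trans eq (sym (⊕-suc k n)))))
      (𝐲-at-n n refl n≢0 ,
       k⊕-distinct (s≤s (ℕ.m≤n+m n 2)) ℕ.≤-refl (ℕ.<⇒≢ (ℕ.m<n⇒m<1+n ℕ.≤-refl)))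

  redundant : ∀ {I} s s′ i d → d < M → Odd d → el s i ∈ I → el s′ (i ⊕ d) ∈ I →
              ∃[ k ] k ≢ i × k ≢ i ⊕ d × Redundant I k
  redundant {I} s s′ i d (s≤s d≤2+n) d-odd i∈I j∈I = by (ℕ.<-cmp d n)
    where
    d<M : d < M
    d<M = s≤s d≤2+n
    ≢i : ∀ {t} → suc t < M → i ⊕ suc t ≢ i
    ≢i t< eq = ⊕-distinct i t< (s≤s z≤n) (λ ()) (trans eq (sym (⊕-zero i)))
    not-even : ∀ {t} → Even t → d ≢ t
    not-even t-even refl with () ← trans (sym d-odd) t-even
    by : Tri (d < n) (d ≡ n) (n < d) → ∃[ k ] k ≢ i × k ≢ i ⊕ d × Redundant I k
    by (tri< d<n _ _) = i ⊕ (2 + d) , ≢i 2+d< , ⊕-distinct i 2+d< d<M (ℕ.>⇒≢ (ℕ.m<n⇒m<1+n ℕ.≤-refl)) ,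
                        redundant-apart s s′ i d<n d-odd i∈I j∈I
      where
      2+d< : 2 + d < M
      2+d< = s≤s (s≤s (ℕ.m<n⇒m<1+n d<n))
    by (tri≈ _ d≡n _) = contradiction d≡n (not-even n-even)
    -- Being odd, `d` can now only be m - 2. With `k` the index just before `i`, both `i` and
    -- `i ⊕ d` are neighbours of `k`.
    by (tri> _ _ n<d) = i ⊕ (2 + n) , ≢i ℕ.≤-refl , ⊕-distinct i ℕ.≤-refl d<M (not-even n-even ∘ sym) ,
      redundant-adjacent s s′ (i ⊕ (2 + n))
        (subst (λ j → el s j ∈ I) (sym (trans (⊕-suc i (2 + n)) (⊕-period i))) i∈I)
        (subst (λ j → el s′ j ∈ I) (sym at-j) j∈I)
      where
      d≡1+n : d ≡ suc n
      d≡1+n = ℕ.≤-antisym (ℕ.≤-pred (ℕ.≤∧≢⇒< d≤2+n (not-even n-even))) n<d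
      at-j : i ⊕ (2 + n) ⊕ (2 + n) ≡ i ⊕ d
      at-j = begin
        i ⊕ (2 + n) ⊕ (2 + n) ≡⟨ ⊕-assoc i (2 + n) (2 + n) ⟩
        i ⊕ (2 + n + (2 + n)) ≡⟨ cong (i ⊕_) (sym (ℕ.+-suc (1 + n) (2 + n))) ⟩
        i ⊕ (1 + n + M)       ≡⟨ ⊕-full-turn i (1 + n) ⟩
        i ⊕ (1 + n)           ≡⟨ cong (i ⊕_) d≡1+n ⟨
        i ⊕ d                 ∎
        where open ≡-Reasoning

  -- The two arcs between `i` and `j` have lengths with the odd sum m, so one of them is odd; if it
  -- is the arc from `j` to `i`, the two indices exchange roles.
  redundant-pair : ∀ {I} s s′ i j → i ≢ j → el s i ∈ I → el s′ j ∈ I → ∃[ k ] k ≢ i × k ≢ j × Redundant I k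
  redundant-pair {I} s s′ i j i≢j i∈I j∈I = let (d , d<M , j≡) = ⊕-reach i j in by d d<M j≡ (parity d) refl
    where
    by : ∀ d → d < M → j ≡ i ⊕ d → ∀ p → parity d ≡ p → ∃[ k ] k ≢ i × k ≢ j × Redundant I k
    by d d<M j≡ 1ℙ d-odd =
      let (k , k≢i , k≢ , red) = redundant s s′ i d d<M d-odd i∈I (subst (λ j → el s′ j ∈ I) j≡ j∈I)
      in k , k≢i , (λ k≡j → k≢ (trans k≡j j≡)) , red
    by zero    d<M j≡ 0ℙ d-even = contradiction (sym (trans j≡ (⊕-zero i))) i≢j
    by (suc d) d<M j≡ 0ℙ d-even =
      let (k , k≢j , k≢ , red) = redundant s′ s j c (s≤s (ℕ.m∸n≤m (2 + n) d)) c-odd j∈I (subst (λ i → el s i ∈ I) i≡ i∈I)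
      in k , (λ k≡i → k≢ (trans k≡i i≡)) , k≢j , red
      where
      c : ℕ
      c = M ∸ suc d
      i≡ : i ≡ j ⊕ c
      i≡ = trans (sym (⊕-inverseʳ i (ℕ.<⇒≤ d<M))) (cong (_⊕ c) (sym j≡))
      c-odd : Odd c
      c-odd = begin
        parity c                    ≡⟨ cong (ℙ._+ parity c) d-even ⟨
        parity (suc d) ℙ.+ parity c ≡⟨ ℙ.+-homo-+ (suc d) c ⟨
        parity (suc d + c)          ≡⟨ cong parity (ℕ.m+[n∸m]≡n (ℕ.<⇒≤ d<M)) ⟩
        parity M                    ≡⟨ 1+n-odd ⟩
        1ℙ                          ∎
        where open ≡-Reasoning

  -- The isomorphisms

  ≼-refl : {I S : Subset (M + M)} → S ≼[ I ] S
  ≼-refl x∈ = _ , x∈ , inj₁ refl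

  -- The identity serves as isomorphism. Blocks of `ℋ` dominate themselves, and a block F_J is
  -- dominated by its swap at `j`, which moves elements only inside the class `I`.
  isomorphic-copies : ∀ I j → el true j ∈ I → el false j ∈ I → Isomorphic (θ I) (θ I) (𝒮 1ℙ /* I) (𝒮 0ℙ /* I)
  isomorphic-copies I j j∈I j′∈I = isomorphic {𝒮 1ℙ} {𝒮 0ℙ} (dominates 1ℙ) (dominates 0ℙ)
    where
    open Domination I id (λ _ → refl) id
    in-I : ∀ s → el s j ∈ I
    in-I true  = j∈I
    in-I false = j′∈I
    swap-≼ : ∀ S → pull (swap j) S ≼[ I ] pull id S
    swap-≼ S {x} x∈ = swap j x , ∈-pull⁺ id {S} (∈-pull⁻ (swap j) {S} x∈) , at (over? x)
      where
      at : ∀ {x} → Over x → θ I (swap j x) x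
      at (over s i) with i Fin.≟ j
      ... | no  i≢j  = inj₁ (swap-el-≢ s i≢j)
      ... | yes refl = inj₂ (subst (_∈ I) (sym (swap-el-≡ i s)) (in-I (not s)) , in-I s)
    dominates : ∀ p → Dominates (𝒮 (p ⁻¹)) (𝒮 p)
    dominates p {S} (inj₁ S∈ℋ) = S , inj₁ S∈ℋ , λ x∈ → ≼-refl {I} {pull id S} (∈-pull⁺ id {S} x∈)
    dominates p {S} (inj₂ S∈ℱ) = pull (swap j) S , swap-F j S∈ℱ , swap-≼ S

  isomorphic-redundant : ∀ I k → (∀ {x} → x ∈ I → swap k x ≡ x) → Redundant I k →
                         Isomorphic (θ I) (θ I) (𝒮 1ℙ /* I) (𝒮 0ℙ /* I)
  isomorphic-redundant I k fixed red = isomorphic {𝒮 1ℙ} {𝒮 0ℙ} (dominates 1ℙ) (dominates 0ℙ)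
    where
    swap-θ : ∀ {x y} → θ I x y → θ I (swap k x) (swap k y)
    swap-θ (inj₁ refl)        = inj₁ refl
    swap-θ (inj₂ (x∈I , y∈I)) = inj₂ (subst (_∈ I) (sym (fixed x∈I)) x∈I , subst (_∈ I) (sym (fixed y∈I)) y∈I)

    open Domination I (swap k) (swap-involutive k) swap-θ

    dominate-alternating : ∀ q {S} ε l → ℋ M S → ∣ S ∣ ≡ M → Alternating (kind S) l ε →
                           ∃[ T ] 𝒮 q T × T ≼[ I ] pull (swap k) S
    dominate-alternating q {S} ε l S∈ℋ size alt = by (l Fin.≟ k)
      where
      by : Dec (l ≡ k) → ∃[ T ] 𝒮 q T × T ≼[ I ] pull (swap k) S
      -- The set handed to `red` is the swapped rotation, which is itself no block; this is why
      -- `Redundant` speaks of all sets of size `M` with an alternating word around `k`.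
      by (yes refl) = red q ε (trans (card-swap k S) size) (alternating-cong {g = kind S} {ε = ε}
          (kind-swap k S) alt)
      by (no l≢k)   = S , inj₁ S∈ℋ , subst (S ≼[ I ]_) (sym (swap-stable k S k≢𝐳)) (≼-refl {I} {S})
        where
        k≢𝐳 : kind S k ≢ 𝐳
        k≢𝐳 z = l≢k (sym (alternating-𝐳 {kind S} {l} ε alt k z))

    alternating-A : ∀ {S} l → A M ≡ pull (ρ M ^ label {M} l) S → Alternating (kind S) (lastᶠ ⊕ label {M} l) 0ℙ
    alternating-A {S} l eq = alternating-pull {label {M} l} {lastᶠ} {0ℙ} {S}
      (subst (λ R → Alternating (kind R) lastᶠ 0ℙ) eq (alternating-cong {ε = 0ℙ} kind-A alternating-C⊞1∣C))

    alternating-B : ∀ {S} l → B M ≡ pull (ρ M ^ label {M} l) S → Alternating (kind S) (lastᶠ ⊕ label {M} l) 1ℙ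
    alternating-B {S} l eq = alternating-pull {label {M} l} {lastᶠ} {1ℙ} {S}
      (subst (λ R → Alternating (kind R) lastᶠ 1ℙ) eq (alternating-cong {ε = 1ℙ} kind-B alternating-C∣C⊞1))

    dominates : ∀ p → Dominates (𝒮 (p ⁻¹)) (𝒮 p)
    dominates p {S} S∈@(inj₁ S∈ℋ@(inj₁ S∈⟨A,B⟩)) =
      let (l , eq) = ⟨⟩⁻ {｛ A M ｝ U.∪ ｛ B M ｝} S∈⟨A,B⟩
          size = card-𝒮 p S∈
      in Sum.[ (λ A≡ → dominate-alternating (p ⁻¹) 0ℙ (lastᶠ ⊕ label {M} l) S∈ℋ size (alternating-A {S} l A≡)) ,
               (λ B≡ → dominate-alternating (p ⁻¹) 1ℙ (lastᶠ ⊕ label {M} l) S∈ℋ size (alternating-B {S} l B≡)) ]′ eq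
    dominates p {S} (inj₁ (inj₂ (X , Y , Ω@(_ , X∩Y≡⊥ , _) , ≢₁ , ≢₂ , sgn≡β , S∈))) =
      pull (swap k) S ,
      inj₁ (inj₂ (X , Y , Ω , ≢₁ , ≢₂ , sgn≡β , swap-⟨∣⟩ k {X} {Y} {S} (∩≡⊥⇒disjoint X∩Y≡⊥) S∈)) ,
      ≼-refl {I} {pull (swap k) S}
    dominates p {S} (inj₂ S∈ℱ) = pull (swap k) S , swap-F k S∈ℱ , ≼-refl {I} {pull (swap k) S}

  isomorphic-quotients : ∀ I → ∣ I ∣ ≡ 2 → Isomorphic (θ I) (θ I) (𝒮 1ℙ /* I) (𝒮 0ℙ /* I)
  isomorphic-quotients I ∣I∣≡2 = let (a , b , a≢b , a∈I , b∈I , only) = pair-members I ∣I∣≡2 in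
    by (over? a) (over? b) a≢b a∈I b∈I only
    where
    same-index : ∀ s s′ i → el s i ≢ el s′ i → el s i ∈ I → el s′ i ∈ I →
                 Isomorphic (θ I) (θ I) (𝒮 1ℙ /* I) (𝒮 0ℙ /* I)
    same-index true  false i _   a∈I b∈I = isomorphic-copies I i a∈I b∈I
    same-index false true  i _   a∈I b∈I = isomorphic-copies I i b∈I a∈I
    same-index true  true  i a≢b _   _   = contradiction refl a≢b
    same-index false false i a≢b _   _   = contradiction refl a≢b

    distinct-indices : ∀ s s′ i j → i ≢ j → el s i ∈ I → el s′ j ∈ I →
                       (∀ {x} → x ∈ I → x ≡ el s i ⊎ x ≡ el s′ j) →
                       Isomorphic (θ I) (θ I) (𝒮 1ℙ /* I) (𝒮 0ℙ /* I)
    distinct-indices s s′ i j i≢j a∈I b∈I only =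
      let (k , k≢i , k≢j , red) = redundant-pair s s′ i j i≢j a∈I b∈I
      in isomorphic-redundant I k
        (λ x∈I → Sum.[ (λ x≡a → trans (cong (swap k) x≡a) (trans (swap-el-≢ s (k≢i ∘ sym)) (sym x≡a))) ,
                       (λ x≡b → trans (cong (swap k) x≡b) (trans (swap-el-≢ s′ (k≢j ∘ sym)) (sym x≡b))) ]′ (only x∈I))
        red

    by : ∀ {a b} → Over a → Over b → a ≢ b → a ∈ I → b ∈ I → (∀ {x} → x ∈ I → x ≡ a ⊎ x ≡ b) →
         Isomorphic (θ I) (θ I) (𝒮 1ℙ /* I) (𝒮 0ℙ /* I)
    by (over s i) (over s′ j) a≢b a∈I b∈I only = decide (i Fin.≟ j)
      where
      decide : Dec (i ≡ j) → Isomorphic (θ I) (θ I) (𝒮 1ℙ /* I) (𝒮 0ℙ /* I)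
      decide (yes refl) = same-index s s′ i a≢b a∈I b∈I
      decide (no i≢j)   = distinct-indices s s′ i j i≢j a∈I b∈I only

  stronglyHypomorphic : StronglyHypomorphic (𝒮₁ M) (𝒮₂ M)
  stronglyHypomorphic = record
    { sperner₁   = sperner 1ℙ
    ; sperner₂   = sperner 0ℙ
    ; isomorphic = isomorphic-quotients
    }

proposition3p44 : (m : ℕ) → 3 ≤ m → Odd m → StronglyHypomorphic (𝒮₁ m) (𝒮₂ m)
proposition3p44 (suc (suc (suc n))) (s≤s (s≤s (s≤s _))) m-odd =
  Systems.stronglyHypomorphic n (trans (sym (ℙ.suc-homo-⁻¹ n)) (cong _⁻¹ m-odd))
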